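{- Let $T$ be a finite tree with maximum degree $\Delta(T)=4$. Suppose that the subgraph of $T$ induced by the set of all vertices of degree $4$ is a forest each of whose components is a path of length at most $2$ (that is, a path with at most $2$ edges, equivalently at most $3$ vertices). Then $\chi'_g(T)\leq 5$.
   Context: The $k$-edge-coloring game on a finite simple graph $G$ is played by two players, Alice and Bob, with a set of $k$ colors. Initially all edges of $G$ are uncolored. The players alternately select an uncolored edge and assign it a color from the $k$-color set so that adjacent edges (edges sharing an endpoint) never receive the same color. Bob makes the first move, and Bob is allowed to skip (pass) any number of his turns; Alice is not allowed to skip. Alice wins if eventually all edges of $G$ are colored; otherwise (i.e., if at some point an uncolored edge has no legal color available, so the coloring cannot be completed) Bob wins. The game chromatic index $\chi'_g(G)$ is the least $k$ such that Alice has a winning strategy in the $k$-edge-coloring game on $G$. A vertex of degree $4$ is called a $4$-vertex. -}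

module Defs where

open import Data.Nat using (ℕ; zero; suc; _≤_)
open import Data.Fin using (Fin; zero; suc; toℕ; inject₁; fromℕ; _≟_)
open import Data.List using (length; filter; allFin)
open import Data.Maybe using (Maybe; just; nothing)
open import Data.Product using (Σ; ∃; _×_; _,_; proj₁; proj₂)
open import Data.Sum using (_⊎_; inj₁; inj₂)
open import Data.Unit using (⊤)
open import Data.Bool using (if_then_else_)
open import Relation.Nullary using (¬_; Dec; yes; no)
open import Relation.Nullary.Decidable using (⌊_⌋; _⊎-dec_)
open import Relation.Binary.PropositionalEquality using (_≡_; _≢_)
open import Function.Definitions using (Injective)

record Graph : Set where
  field
    n : ℕ
    m : ℕ
    ends : Fin m → Fin n × Fin n
    loopless : ∀ e → proj₁ (ends e) ≢ proj₂ (ends e)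
    noParallel : ∀ e f →
      ((proj₁ (ends e) ≡ proj₁ (ends f)) × (proj₂ (ends e) ≡ proj₂ (ends f))
       ⊎ (proj₁ (ends e) ≡ proj₂ (ends f)) × (proj₂ (ends e) ≡ proj₁ (ends f)))
      → e ≡ f

module _ (G : Graph) where
  open Graph G

  Incident : Fin n → Fin m → Set
  Incident v e = (proj₁ (ends e) ≡ v) ⊎ (proj₂ (ends e) ≡ v)

  incident? : (v : Fin n) (e : Fin m) → Dec (Incident v e)
  incident? v e = (proj₁ (ends e) ≟ v) ⊎-dec (proj₂ (ends e) ≟ v)

  Adj : Fin n → Fin n → Set
  Adj u v = ∃ λ e → (Incident u e × Incident v e) × u ≢ v

  degree : Fin n → ℕ
  degree v = length (filter (incident? v) (allFin m))

  data ReachIn (P : Fin n → Set) : Fin n → Fin n → Set where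
    here : ∀ {u} → P u → ReachIn P u u
    step : ∀ {u v w} → P u → Adj u v → ReachIn P v w → ReachIn P u w

  Connected : Set
  Connected = ∀ u v → ReachIn (λ _ → ⊤) u v

  HasCycle : Set
  HasCycle = ∃ λ j → Σ (Fin (suc (suc (suc j))) → Fin n) λ f →
    Injective _≡_ _≡_ f ×
    (∀ (i : Fin (suc (suc j))) → Adj (f (inject₁ i)) (f (suc i))) ×
    Adj (f (fromℕ (suc (suc j)))) (f zero)

  IsTree : Set
  IsTree = Connected × ¬ HasCycle

  MaxDegreeIs : ℕ → Set
  MaxDegreeIs d = (∀ v → degree v ≤ d) × ∃ λ v → degree v ≡ d

  FourVertex : Fin n → Set
  FourVertex v = degree v ≡ 4

  -- Every component of the subgraph induced by the 4-vertices is a path with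
  -- at most 2 edges: the component of v is enumerated as p 0, ..., p j (j ≤ 2)
  -- without repetition, and p i, p i' adjacent iff |i - i'| = 1.
  FourVerticesInducePathsLe2 : Set
  FourVerticesInducePathsLe2 = ∀ v → FourVertex v →
    ∃ λ j → j ≤ 2 × Σ (Fin (suc j) → Fin n) λ p →
      Injective _≡_ _≡_ p ×
      (∀ w → (ReachIn FourVertex v w → ∃ λ i → p i ≡ w)
           × ((∃ λ i → p i ≡ w) → ReachIn FourVertex v w)) ×
      (∀ i i' → (Adj (p i) (p i') → (toℕ i ≡ suc (toℕ i') ⊎ toℕ i' ≡ suc (toℕ i)))
              × ((toℕ i ≡ suc (toℕ i') ⊎ toℕ i' ≡ suc (toℕ i)) → Adj (p i) (p i')))

  -- The k-edge-coloring game (Bob moves first, Bob may pass, Alice may not).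

  Coloring : ℕ → Set
  Coloring k = Fin m → Maybe (Fin k)

  AdjEdges : Fin m → Fin m → Set
  AdjEdges e f = e ≢ f × ∃ λ v → Incident v e × Incident v f

  Legal : ∀ {k} → Coloring k → Fin m → Fin k → Set
  Legal c e α = c e ≡ nothing × (∀ f → AdjEdges e f → c f ≢ just α)

  Complete : ∀ {k} → Coloring k → Set
  Complete c = ∀ e → ∃ λ α → c e ≡ just α

  Blocked : ∀ {k} → Coloring k → Set
  Blocked c = ∃ λ e → c e ≡ nothing × (∀ α → ¬ Legal c e α)

  update : ∀ {k} → Coloring k → Fin m → Fin k → Coloring k
  update c e α f = if ⌊ f ≟ e ⌋ then just α else c f

  -- AliceWinsA c : Alice to move at position c, and she has a winning strategy.
  -- AliceWinsB c : Bob to move at position c, and Alice has a winning strategy.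
  data AliceWinsA {k : ℕ} : Coloring k → Set
  data AliceWinsB {k : ℕ} : Coloring k → Set

  data AliceWinsA {k} where
    doneA : ∀ {c} → Complete c → AliceWinsA c
    move  : ∀ {c} → ¬ Blocked c → (e : Fin m) (α : Fin k) → Legal c e α →
            AliceWinsB (update c e α) → AliceWinsA c

  data AliceWinsB {k} where
    doneB : ∀ {c} → Complete c → AliceWinsB c
    reply : ∀ {c} → ¬ Blocked c →
            AliceWinsA c →                                   -- Bob passes
            (∀ e α → Legal c e α → AliceWinsA (update c e α)) →
            AliceWinsB c

  emptyColoring : (k : ℕ) → Coloring k
  emptyColoring k _ = nothing

  AliceWinsGame : ℕ → Set
  AliceWinsGame k = AliceWinsB (emptyColoring k)

  -- χ'_g(G) ≤ b : the least k for which Alice wins is at most b,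
  -- i.e. Alice wins the k-game for some k ≤ b.
  GameChromaticIndexLe : ℕ → Set
  GameChromaticIndexLe b = ∃ λ k → k ≤ b × AliceWinsGame k

{-# OPTIONS --safe #-}
module Submission where

open import Defs
open import Data.Empty using (⊥; ⊥-elim)
open import Data.Fin using (Fin; zero; suc; toℕ; inject₁; fromℕ; _≟_)
open import Data.Fin.Properties using (all?; any?; injective⇒≤; toℕ-injective; toℕ<n)
open import Data.List using (List; []; _∷_; length; filter; allFin; lookup)
open import Data.List.Membership.Propositional using (_∈_; _∉_)
open import Data.List.Membership.Propositional.Properties using (∈-allFin; ∈-filter⁺; ∈-filter⁻; ∈-lookup)
import Data.List.Membership.DecPropositional as DecMembership
open import Data.List.Properties using (filter-all; filter-accept; filter-reject)
open import Data.List.Relation.Unary.All as All using (All; []; _∷_)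
open import Data.List.Relation.Unary.All.Properties using (¬Any⇒All¬)
open import Data.List.Relation.Unary.AllPairs using ([]; _∷_)
open import Data.List.Relation.Unary.Any using (here; there; index)
open import Data.List.Relation.Unary.Any.Properties using (lookup-index)
open import Data.List.Relation.Unary.Unique.Propositional using (Unique)
open import Data.List.Relation.Unary.Unique.Propositional.Properties using (allFin⁺; filter⁺)
open import Data.Maybe using (Maybe; just; nothing)
open import Data.Maybe.Properties using (just-injective; ≡-dec)
open import Data.Nat as ℕ using (ℕ; zero; suc; _≤_; _<_; z≤n; s≤s)
open import Data.Nat.Properties using (≤-refl; ≤-trans; <-irrefl; <⇒≤; <-≤-trans; m≤n⇒m≤1+n; ≤-pred; <-asym; ≤∧≢⇒<; suc-injective)
open import Data.Product using (Σ; ∃; _×_; _,_; proj₁; proj₂)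
open import Data.Sum using (_⊎_; inj₁; inj₂; [_,_]′; swap)
open import Data.Unit using (⊤; tt)
open import Function using (_∘_; id; case_of_)
open import Relation.Binary.PropositionalEquality using (_≡_; _≢_; refl; sym; trans; cong; subst; ≢-sym)
open import Relation.Nullary using (¬_; Dec; yes; no; contradiction)
open import Relation.Nullary.Decidable using (_×-dec_; _⊎-dec_; _→-dec_; ¬?; map′; decidable-stable)

-- The tree is rooted at a vertex of degree at most 3, and an edge is active if it or some
-- edge below it is coloured.  Only edges at a 4-vertex can ever be blocked, and a move of Bob
-- at e concerns just the stars near the lowest edge on the way up from e that was already
-- active, so Alice answers locally, restoring an invariant of every star at a 4-vertex z:
-- as long as the edge above z is blank, only one child of z is active; afterwards, roughly,
-- either all children of z are coloured, or some blank child is inactive or harmless (it sees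
-- a colour of z once more at its lower end) and each of the other two is coloured, harmless,
-- or has one active child only.  When this fails, Alice colours the edge above z or a child of
-- z, or she makes a child of z harmless by repeating a colour of z on an inactive grandchild.
-- If z is the upper and middle vertex of a path of three 4-vertices, the edges below the other
-- two cannot be used in this way, and the colours that they share with z are recorded as well.

-- The numbers: an edge whose ends both have degree at most 3 meets at most four others, so five
-- colours suffice there; with one end at a 4-vertex it meets up to five, with both up to six. A
-- child of `z` with at most two children is thus settled by one repeated colour, while a child at a
-- 4-vertex would need two: this is why two such children of one `z` are the hard case. Rooting at a
-- vertex of degree at most 3 makes every 4-vertex the lower end of one edge with exactly three
-- children. Bob moves once before Alice can respond, so a blank edge must be kept at three colours,
-- or at four for good. Alice cannot pass, so besides local answers she needs a spare move that
-- breaks no star. At a path of three 4-vertices the danger is a colour that occurs below both outer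
-- edges and is missing from the star of `z`; Alice neutralises it by using it inside the star, and
-- the case distinctions mostly decide which edge of the star can take it. The length bound on paths
-- stops a cascade: neither the parent of such a `z` nor a child of an outer edge is at a 4-vertex.

just≢nothing : ∀ {A : Set} {x : A} {y : Maybe A} → y ≡ just x → y ≢ nothing
just≢nothing refl ()

-- Rooted trees described by their edges

-- An edge stands for its lower end, so stars of a rooted tree are sets of edges:
-- the star at z consists of z itself and its children.
module Shape {m : ℕ} (par : Fin m → Maybe (Fin m)) (Four : Fin m → Set) where

  Child : Fin m → Fin m → Set
  Child h z = par h ≡ just z

  Up : Fin m → Fin m → Set
  Up e t = (t ≢ e × par t ≡ par e) ⊎ par e ≡ just t

  record Kids (z i j k : Fin m) : Set where
    field
      kid₁ : Child i z
      kid₂ : Child j z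
      kid₃ : Child k z
      ≢₁₂ : i ≢ j
      ≢₁₃ : i ≢ k
      ≢₂₃ : j ≢ k
      only : ∀ {h} → Child h z → h ≡ i ⊎ h ≡ j ⊎ h ≡ k

  -- The form in which it is used: of any two children with activity below them, one has at most two
  -- children and can be made harmless.
  Plain : Fin m → Set
  Plain z = ∀ {h k} → Child h z → Child k z → h ≢ k → ¬ Four h ⊎ ¬ Four k

  -- z is the middle and upper vertex of a path u z w of 4-vertices.
  record Centre (z u w x : Fin m) : Set where
    field
      kids : Kids z u w x
      four₁ : Four u
      four₂ : Four w
      narrow₃ : ¬ Four x
      leaf₁ : ∀ {k} → Child k u → ¬ Four k
      leaf₂ : ∀ {k} → Child k w → ¬ Four k
      top : ∀ {p} → Child z p → ¬ Four p

  private variable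
    z u w x i j k : Fin m

  swap₁₂ : Kids z i j k → Kids z j i k
  swap₁₂ ks = record { kid₁ = kid₂ ; kid₂ = kid₁ ; kid₃ = kid₃ ; ≢₁₂ = ≢-sym ≢₁₂ ; ≢₁₃ = ≢₂₃ ; ≢₂₃ = ≢₁₃
    ; only = λ ch → case only ch of λ { (inj₁ a) → inj₂ (inj₁ a) ; (inj₂ (inj₁ a)) → inj₁ a ; (inj₂ (inj₂ a)) → inj₂ (inj₂ a) } }
    where open Kids ks

  swap₂₃ : Kids z i j k → Kids z i k j
  swap₂₃ ks = record { kid₁ = kid₁ ; kid₂ = kid₃ ; kid₃ = kid₂ ; ≢₁₂ = ≢₁₃ ; ≢₁₃ = ≢₁₂ ; ≢₂₃ = ≢-sym ≢₂₃
    ; only = λ ch → case only ch of λ { (inj₁ a) → inj₁ a ; (inj₂ (inj₁ a)) → inj₂ (inj₂ a) ; (inj₂ (inj₂ a)) → inj₂ (inj₁ a) } }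
    where open Kids ks

  swap₁₃ : Kids z i j k → Kids z k j i
  swap₁₃ ks = swap₁₂ (swap₂₃ (swap₁₂ ks))

  mirror : Centre z u w x → Centre z w u x
  mirror C = record { kids = swap₁₂ kids ; four₁ = four₂ ; four₂ = four₁ ; narrow₃ = narrow₃
    ; leaf₁ = leaf₂ ; leaf₂ = leaf₁ ; top = top }
    where open Centre C

-- All that the game needs from the tree; vertices enter only through `adjacent`. `narrow` and
-- `roots` are mere upper bounds: the two edges they name may coincide and need not be in the stated
-- position.
record Rooted (G : Graph) : Set₁ where
  open Graph G
  field
    par : Fin m → Maybe (Fin m)
    depth : Fin m → ℕ
    Four : Fin m → Set
  open Shape par Four public
  field
    par-depth : ∀ {e p} → Child e p → depth p < depth e
    adjacent : ∀ {e f} → AdjEdges G e f → Up e f ⊎ Child f e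
    four? : ∀ e → Dec (Four e)
    kids : ∀ {z} → Four z → ∃ λ i → ∃ λ j → ∃ λ k → Kids z i j k
    narrow : ∀ {x} → ¬ Four x → ∃ λ y → ∃ λ y′ → ∀ {f} → Child f x → f ≡ y ⊎ f ≡ y′
    roots : ∀ {e} → par e ≡ nothing → ∃ λ a → ∃ λ b → ∀ {t} → Up e t → t ≡ a ⊎ t ≡ b
    kind : ∀ {z} → Four z → Plain z ⊎ ∃ λ u → ∃ λ w → ∃ λ x → Centre z u w x

-- Otherwise the position of a colour in `l` would inject five colours into four places.
fresh-colour : (l : List (Fin 5)) → length l ≤ 4 → ∃ λ α → α ∉ l
fresh-colour l l≤4 with any? (λ α → ¬? (α ∈? l))
  where open DecMembership (_≟_ {5}) using (_∈?_)
... | yes p = p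
... | no ¬p = contradiction (≤-trans (injection⇒≤ l λ α → decidable-stable (α ∈? l) λ α∉ → ¬p (α , α∉)) l≤4) λ { (s≤s (s≤s (s≤s (s≤s ())))) }
  where
  open DecMembership (_≟_ {5}) using (_∈?_)
  injection⇒≤ : (l : List (Fin 5)) → (∀ α → α ∈ l) → 5 ≤ length l
  injection⇒≤ l f = injective⇒≤ {f = λ α → index (f α)} λ {α} {β} eq →
    trans (lookup-index (f α)) (trans (cong (lookup l) eq) (sym (lookup-index (f β))))

-- The order of the tree, the states of a child, and the invariant of a star

module Play (G : Graph) (R : Rooted G) where
  open Graph G using (m)
  open Rooted R public

  Edge : Set
  Edge = Fin m

  Col : Set
  Col = Coloring G 5

  private variable
    c c′ c″ : Col
    e f g h i j k p s t u w x y z : Edge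
    α β d : Fin 5

  infix 4 _≼_ _≼?_
  data _≼_ (e : Edge) : Edge → Set where
    self : e ≼ e
    up   : e ≼ h → Child h g → e ≼ g

  ≼-depth : e ≼ f → depth f ≤ depth e
  ≼-depth self = ≤-refl
  ≼-depth (up p q) = ≤-trans (<⇒≤ (par-depth q)) (≼-depth p)

  ≼-trans : e ≼ f → f ≼ g → e ≼ g
  ≼-trans p self = p
  ≼-trans p (up q r) = up (≼-trans p q) r

  acyclic : Child h z → ¬ z ≼ h
  acyclic ch p = <-irrefl refl (<-≤-trans (par-depth ch) (≼-depth p))

  climb : e ≼ z → e ≡ z ⊎ ∃ λ p → Child e p × p ≼ z
  climb self = inj₁ refl
  climb (up p q) with climb p
  ... | inj₁ refl = inj₂ (_ , q , self)
  ... | inj₂ (p′ , r , s) = inj₂ (p′ , r , up s q)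

  ≼-total : e ≼ f → e ≼ g → f ≼ g ⊎ g ≼ f
  ≼-total self q = inj₁ q
  ≼-total (up p r) q with ≼-total p q
  ... | inj₂ s = inj₂ (up s r)
  ... | inj₁ s with climb s
  ...   | inj₁ refl = inj₂ (up self r)
  ...   | inj₂ (p′ , r′ , s′) with just-injective (trans (sym r) r′)
  ...     | refl = inj₁ s′

  same-parent : Child h z → Child k z → h ≼ k → h ≡ k
  same-parent a b q with climb q
  ... | inj₁ eq = eq
  ... | inj₂ (p , r , s) with just-injective (trans (sym r) a)
  ...   | refl = ⊥-elim (acyclic b s)

  -- Edges above `e` form a chain, and comparable siblings coincide. This makes moves local: a move
  -- at or below a child leaves the other two children alone.
  branch : Child h z → Child k z → e ≼ h → e ≼ k → h ≡ k
  branch a b p q with ≼-total p q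
  ... | inj₁ r = same-parent a b r
  ... | inj₂ r = sym (same-parent b a r)

  child? : ∀ h z → Dec (Child h z)
  child? h z = ≡-dec _≟_ (par h) (just z)

  _≼?_ : ∀ e f → Dec (e ≼ f)
  e ≼? f = go (suc (depth e)) e ≤-refl
    where
    go : ∀ n e → depth e < n → Dec (e ≼ f)
    go (suc n) e (s≤s b) with e ≟ f
    ... | yes refl = yes self
    ... | no e≢f with par e in eq
    ...   | nothing = no λ q → case climb q of λ
              { (inj₁ r) → e≢f r ; (inj₂ (p , r , _)) → just≢nothing r eq }
    ...   | just p with go n p (<-≤-trans (par-depth eq) b)
    ...     | yes q = yes (≼-trans (up self eq) q)
    ...     | no ¬q = no λ q → case climb q of λ
              { (inj₁ r) → e≢f r
              ; (inj₂ (p′ , r , s)) → ¬q (subst (_≼ f) (just-injective (trans (sym r) eq)) s) }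

  Coloured Blank Inactive : Col → Edge → Set
  Coloured c e = ∃ λ α → c e ≡ just α
  Blank c e = c e ≡ nothing
  Inactive c e = ∀ {f} → f ≼ e → Blank c f

  K⊎U : ∀ (c : Col) e → Coloured c e ⊎ Blank c e
  K⊎U c e with c e
  ... | just α = inj₁ (α , refl)
  ... | nothing = inj₂ refl

  K-U : ∀ {v : Maybe (Fin 5)} → (∃ λ α → v ≡ just α) → v ≢ nothing
  K-U (_ , a) = just≢nothing a

  u? : ∀ (c : Col) e → Dec (Blank c e)
  u? c e = ≡-dec _≟_ (c e) nothing

  has? : ∀ (c : Col) e α → Dec (c e ≡ just α)
  has? c e α = ≡-dec _≟_ (c e) (just α)

  inact? : ∀ (c : Col) e → Dec (Inactive c e)
  inact? c e = map′ (λ h {f} → h f) (λ h f → h) (all? λ f → (f ≼? e) →-dec u? c f)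

  inact-≼ : Inactive c e → f ≼ e → Inactive c f
  inact-≼ a p q = a (≼-trans q p)

  inact-intro : Blank c h → (∀ {y} → Child y h → Inactive c y) → Inactive c h
  inact-intro a b self = a
  inact-intro a b (up p q) = b q p

  K-act : Coloured c e → e ≼ z → ¬ Inactive c z
  K-act k p a = K-U k (a p)

  Star : Edge → Edge → Set
  Star z s = s ≡ z ⊎ Child s z

  InZ : Col → Edge → Fin 5 → Set
  InZ c z d = ∃ λ s → Star z s × c s ≡ just d

  star? : ∀ z s → Dec (Star z s)
  star? z s = (s ≟ z) ⊎-dec child? s z

  inZ? : ∀ c z d → Dec (InZ c z d)
  inZ? c z d = any? λ s → star? z s ×-dec has? c s d

  -- An upper bound: `y` need not be active, nor a child of `h`, so inactive edges are included and
  -- `h` itself can serve as `y`.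
  OneActive : Col → Edge → Set
  OneActive c h = Blank c h × ∃ λ y → ∀ {f} → Child f h → f ≢ y → Inactive c f

  -- A child h of z that sees at most four colours, whatever happens.
  Dead : Col → Edge → Edge → Set
  Dead c z h = ¬ Four h × Blank c h ×
    ∃ λ y → ∀ {f} → Child f h → f ≢ y → ∃ λ α → c f ≡ just α × InZ c z α

  data Soft (c : Col) (z h : Edge) : Set where
    col : Coloured c h → Soft c z h
    one : OneActive c h → Soft c z h
    dead : Dead c z h → Soft c z h

  -- A child that can be coloured last: it has room itself, and as long as it is blank each sibling
  -- meets one colour less.
  data Quiet (c : Col) (z h : Edge) : Set where
    dead : Dead c z h → Quiet c z h
    inact : Inactive c h → Quiet c z h

  inact-one : Inactive c h → OneActive c h
  inact-one {h = h} a = a self , h , λ ch _ → inact-≼ a (up self ch)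

  soft : Quiet c z h → Soft c z h
  soft (dead a) = dead a
  soft (inact a) = one (inact-one a)

  quiet-U : Quiet c z h → Blank c h
  quiet-U (dead (_ , a , _)) = a
  quiet-U (inact a) = a self

  -- `Soft` without the case that refers to the colours of the star. Children at a 4-vertex cannot
  -- be `Dead`, so for them this is all that `Soft` offers.
  data Tight (c : Col) (h : Edge) : Set where
    col : Coloured c h → Tight c h
    one : OneActive c h → Tight c h

  act-soft : Tight c h → Soft c z h
  act-soft (col a) = col a
  act-soft (one a) = one a

  data Waiting (c : Col) (z : Edge) : Set where
    waiting : Blank c z → Child h z → (∀ {k} → Child k z → k ≢ h → Inactive c k) → Tight c h → Waiting c z

  -- In `s₁` the blank child `j` leaves a blank `OneActive` sibling with three coloured neighbours.
  -- In `s₂` both siblings of `i` are blank, so `i` has room even if both of its children are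
  -- coloured; this is what remains after `z` was coloured to repair a `double`.
  data PlainInv (c : Col) (z : Edge) : Set where
    done : (∀ {h} → Child h z → Coloured c h) → PlainInv c z
    s₁ : Kids z i j k → Soft c z i → Quiet c z j → Soft c z k → PlainInv c z
    s₂ : Kids z i j k → ¬ Four i → Blank c i → Quiet c z j → Quiet c z k → PlainInv c z

  -- Colours below `u` then cost nothing: all that `u` sees is on the other three edges of the star.
  Tame : Col → Edge → Edge → Set
  Tame c z u = ∀ {k d} → Child k u → c k ≡ just d → InZ c z d

  data Mild (c : Col) (z u : Edge) : Set where
    col : Coloured c u → Mild c z u
    tame : OneActive c u → Tame c z u → Mild c z u

  -- What makes `cut` possible: a colour below `w` that is missing from the star is then available
  -- at `u`, and putting it there makes `w` tame.
  NotSame : Col → Edge → Edge → Edge → Set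
  NotSame c z u w = Blank c u → Blank c w → ∀ {k l d} → Child k u → Child l w →
    c k ≡ just d → c l ≡ just d → InZ c z d

  -- A precaution for the time when `w` becomes active: if `u` and `w` then share a new colour, the
  -- coloured child of `x` does not carry it, so `x` can take it.
  Differ : Col → Edge → Edge → Set
  Differ c u x = ∃ λ y → ∃ λ d → Child y x × c y ≡ just d × (∀ {k} → Child k u → c k ≢ just d)

  -- With `x` coloured, `u` and `w` have no blank `x` to rely on, so colours below them must be
  -- repeated in the star (`mild`). A quiet `x` spares them a colour (`third`). In the other cases
  -- the inactive `w` is the blank sibling that gives room; `lone` allows any activity below `x`.
  data CentreInv (c : Col) (z u w x : Edge) : Set where
    mild : Coloured c x → Mild c z u → Mild c z w → CentreInv c z u w x
    third : Quiet c z x → Tight c u → Tight c w → NotSame c z u w → CentreInv c z u w x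
    half : Coloured c u → Inactive c w → OneActive c x → CentreInv c z u w x
    both : OneActive c u → Inactive c w → OneActive c x → Tame c z u ⊎ Differ c u x → CentreInv c z u w x
    lone : Inactive c u → Inactive c w → Blank c x → CentreInv c z u w x

  -- A blank z with this property sees at most four colours, whatever happens.
  Safe : Col → Edge → Set
  Safe c z = Coloured c z ⊎ (∃ λ s → ∃ λ t → ∃ λ d → Child s z × Up z t × c s ≡ just d × c t ≡ just d)

  data Inv (c : Col) (z : Edge) : Set where
    wait : Waiting c z → Inv c z
    plain : Plain z → Coloured c z → PlainInv c z → Inv c z
    centre : Centre z u w x → Safe c z → CentreInv c z u w x → Inv c z

  AllInv : Col → Set
  AllInv c = ∀ {z} → Four z → Inv c z

  -- A move described pointwise, so that the invariants can be treated without unfolding the test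
  -- inside `update`.
  record Step (c c′ : Col) (e : Edge) (α : Fin 5) : Set where
    field
      before : Blank c e
      after  : c′ e ≡ just α
      off    : ∀ {f} → f ≢ e → c′ f ≡ c f

  open Step public

  update-step : c e ≡ nothing → Step c (update G c e α) e α
  update-step {c} {e} {α} b = record { before = b ; after = aft ; off = of }
    where
    aft : update G c e α e ≡ just α
    aft with e ≟ e
    ... | yes _ = refl
    ... | no ¬p = contradiction refl ¬p
    of : ∀ {f} → f ≢ e → update G c e α f ≡ c f
    of {f} ne with f ≟ e
    ... | yes p = contradiction p ne
    ... | no _ = refl

  Ext : Col → Col → Set
  Ext c c′ = ∀ {f β} → c f ≡ just β → c′ f ≡ just β

  step-ext : Step c c′ e α → Ext c c′
  step-ext {e = e} st {f} cf with f ≟ e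
  ... | yes refl = contradiction (before st) (just≢nothing cf)
  ... | no ne = trans (off st ne) cf

  -- Nothing that the invariant of a star says about its child h can change.
  record CalmAt (c c′ : Col) (h : Edge) : Set where
    field
      same : c′ h ≡ c h
      below : Blank c h → ∀ {y} → Child y h → Inactive c y → Inactive c′ y

  Calm : Col → Col → Edge → Set
  Calm c c′ z = ∀ {h} → Child h z → CalmAt c c′ h

  -- Needed besides `CalmAt` at a centre, where colours below the 4-children are recorded and not
  -- only activity: colouring an active blank grandchild is calm but not still.
  Still : Col → Col → Edge → Set
  Still c c′ h = Blank c h → ∀ {k} → Child k h → c′ k ≡ c k

  module _ (ca : CalmAt c c′ h) where
    open CalmAt ca
    K-calm : Coloured c h → Coloured c′ h
    K-calm (α , a) = α , trans same a
    U-calm : Blank c h → Blank c′ h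
    U-calm a = trans same a
    One-calm : OneActive c h → OneActive c′ h
    One-calm (a , y , b) = trans same a , y , λ ch ne → below a ch (b ch ne)
    Act-calm : Tight c h → Tight c′ h
    Act-calm (col a) = col (K-calm a)
    Act-calm (one a) = one (One-calm a)
    Inact-calm : Inactive c h → Inactive c′ h
    Inact-calm a = inact-intro (U-calm (a self)) λ ch → below (a self) ch (inact-≼ a (up self ch))

  InZ-ext : Ext c c′ → InZ c z d → InZ c′ z d
  InZ-ext ex (s , a , b) = s , a , ex b

  Dead-ext : Ext c c′ → Blank c′ h → Dead c z h → Dead c′ z h
  Dead-ext ex a (nf , _ , y , b) = nf , a , y , λ ch ne →
    let (α , p , q) = b ch ne in α , ex p , InZ-ext ex q

  module _ (ex : Ext c c′) (ca : CalmAt c c′ h) where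
    Soft-calm : Soft c z h → Soft c′ z h
    Soft-calm (col a) = col (K-calm ca a)
    Soft-calm (one a) = one (One-calm ca a)
    Soft-calm (dead a@(_ , b , _)) = dead (Dead-ext ex (U-calm ca b) a)
    Quiet-calm : Quiet c z h → Quiet c′ z h
    Quiet-calm (dead a@(_ , b , _)) = dead (Dead-ext ex (U-calm ca b) a)
    Quiet-calm (inact a) = inact (Inact-calm ca a)

  Tame-calm : Ext c c′ → Still c c′ u → Blank c u → Tame c z u → Tame c′ z u
  Tame-calm ex st cu a ch ck = InZ-ext ex (a ch (trans (sym (st cu ch)) ck))

  Mild-calm : Ext c c′ → CalmAt c c′ u → Still c c′ u → Mild c z u → Mild c′ z u
  Mild-calm ex ca st (col a) = col (K-calm ca a)
  Mild-calm ex ca st (tame a b) = tame (One-calm ca a) (Tame-calm ex st (proj₁ a) b)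

  NotSame-calm : Ext c c′ → CalmAt c c′ u → CalmAt c c′ w → Still c c′ u → Still c c′ w →
    NotSame c z u w → NotSame c′ z u w
  NotSame-calm ex cu cw su sw ns uu uw a b p r =
    let uu′ = trans (sym (CalmAt.same cu)) uu ; uw′ = trans (sym (CalmAt.same cw)) uw in
    InZ-ext ex (ns uu′ uw′ a b (trans (sym (su uu′ a)) p) (trans (sym (sw uw′ b)) r))

  Differ-calm : Ext c c′ → Blank c u → Still c c′ u → Differ c u x → Differ c′ u x
  Differ-calm ex cu st (y , d , a , b , f) = y , d , a , ex b , λ ch r → f ch (trans (sym (st cu ch)) r)

  plain-calm : Ext c c′ → Calm c c′ z → PlainInv c z → PlainInv c′ z
  plain-calm ex ca (done a) = done λ ch → K-calm (ca ch) (a ch)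
  plain-calm ex ca (s₁ ks a b d) = s₁ ks (Soft-calm ex (ca kid₁) a) (Quiet-calm ex (ca kid₂) b) (Soft-calm ex (ca kid₃) d)
    where open Kids ks
  plain-calm ex ca (s₂ ks nf a b d) = s₂ ks nf (U-calm (ca kid₁) a) (Quiet-calm ex (ca kid₂) b) (Quiet-calm ex (ca kid₃) d)
    where open Kids ks

  centre-calm : Centre z u w x → Ext c c′ → Calm c c′ z → Still c c′ u → Still c c′ w →
    CentreInv c z u w x → CentreInv c′ z u w x
  centre-calm {z} {u} {w} {x} {c} {c′} C ex ca su sw = go
    where
    open Kids (Centre.kids C)
    cu = ca kid₁
    cw = ca kid₂
    cx = ca kid₃
    go : CentreInv c z u w x → CentreInv c′ z u w x
    go (mild a b d) = mild (K-calm cx a) (Mild-calm ex cu su b) (Mild-calm ex cw sw d)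
    go (third a b d ns) = third (Quiet-calm ex cx a) (Act-calm cu b) (Act-calm cw d) (NotSame-calm ex cu cw su sw ns)
    go (half a b d) = half (K-calm cu a) (Inact-calm cw b) (One-calm cx d)
    go (both a b d (inj₁ t)) = both (One-calm cu a) (Inact-calm cw b) (One-calm cx d) (inj₁ (Tame-calm ex su (proj₁ a) t))
    go (both a b d (inj₂ t)) = both (One-calm cu a) (Inact-calm cw b) (One-calm cx d) (inj₂ (Differ-calm ex (proj₁ a) su t))
    go (lone a b d) = lone (Inact-calm cu a) (Inact-calm cw b) (U-calm cx d)

  Safe-ext : Ext c c′ → Safe c z → Safe c′ z
  Safe-ext ex (inj₁ (α , a)) = inj₁ (α , ex a)
  Safe-ext ex (inj₂ (s , t , d , a , b , p , r)) = inj₂ (s , t , d , a , b , ex p , ex r)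

  wait-calm : c′ z ≡ c z → Calm c c′ z → Waiting c z → Waiting c′ z
  wait-calm eq ca (waiting uz ch oth a) =
    waiting (trans eq uz) ch (λ ck ne → Inact-calm (ca ck) (oth ck ne)) (Act-calm (ca ch) a)

  StillCentre : Col → Col → Edge → Set
  StillCentre c c′ z = ∀ {u w x} → Centre z u w x → Still c c′ u × Still c c′ w

  inv-calm : Ext c c′ → c′ z ≡ c z → Calm c c′ z → StillCentre c c′ z → Inv c z → Inv c′ z
  inv-calm ex eq ca sc (wait a) = wait (wait-calm eq ca a)
  inv-calm ex eq ca sc (plain p (α , a) b) = plain p (α , ex a) (plain-calm ex ca b)
  inv-calm ex eq ca sc (centre C s b) = centre C (Safe-ext ex s) (centre-calm C ex ca (proj₁ (sc C)) (proj₂ (sc C)) b)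

-- The effect of one move on the stars that it does not endanger

module Steps (G : Graph) (R : Rooted G) where
  open Graph G using (m)
  open Play G R

  private variable
    c c′ c″ : Col
    e f g h i j k p s t u w x y z : Edge
    α β d : Fin 5

  module _ (st : Step c c′ e α) where

    U-off : f ≢ e → Blank c f → Blank c′ f
    U-off ne a = trans (off st ne) a

    U-back : Blank c′ f → Blank c f
    U-back {f} a with f ≟ e
    ... | yes refl = before st
    ... | no ne = trans (sym (off st ne)) a

    inact-off : ¬ e ≼ y → Inactive c y → Inactive c′ y
    inact-off ne a p = U-off (λ { refl → ne p }) (a p)

    calmAt-off : ¬ e ≼ h → CalmAt c c′ h
    calmAt-off ne = record
      { same = off st (λ { refl → ne self })
      ; below = λ _ ch → inact-off λ q → ne (up q ch) }

    calmAt-coloured : Coloured c h → CalmAt c c′ h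
    calmAt-coloured a = record
      { same = off st (λ { refl → K-U a (before st) })
      ; below = λ b → ⊥-elim (K-U a b) }

    -- `y` was already counted as active, so a move at or below it makes no further child of `h`
    -- active.
    calmAt-deep : e ≼ y → Child y h → ¬ Inactive c y → CalmAt c c′ h
    calmAt-deep {y} q ch na = record
      { same = off st (λ { refl → acyclic ch q })
      ; below = λ _ {y′} ch′ a → inact-off (λ q′ → case branch ch ch′ q q′ of λ { refl → na a }) a }

    calm-but : e ≼ h → Child h z → CalmAt c c′ h → Calm c c′ z
    calm-but {h} q ch a {h′} ch′ with h′ ≟ h
    ... | yes refl = a
    ... | no ne = calmAt-off λ q′ → ne (branch ch′ ch q′ q)

    still-but : e ≼ h → Child h z → Child u z → u ≢ h → Still c c′ u
    still-but q ch cu ne _ ck = off st λ { refl → ne (branch cu ch (up self ck) q) }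

    inv-away : ¬ e ≼ z → Inv c z → Inv c′ z
    inv-away ne = inv-calm (step-ext st) (off st λ { refl → ne self }) (λ ch → calmAt-off (out ch))
      λ C → let open Kids (Centre.kids C) in
        (λ _ ck → off st λ { refl → out kid₁ (up self ck) }) , (λ _ ck → off st λ { refl → out kid₂ (up self ck) })
      where
      out : Child h _ → ¬ e ≼ h
      out ch q = ne (up q ch)

    -- The invariant of a star makes no claim about the edges below a coloured child.
    inv-coloured : e ≼ h → Child h z → Coloured c h → Inv c z → Inv c′ z
    inv-coloured {h} {z} q ch kh = inv-calm (step-ext st) (off st λ { refl → acyclic ch q })
      (calm-but q ch (calmAt-coloured kh)) λ C → let open Kids (Centre.kids C) in still kid₁ , still kid₂
      where
      still : Child u z → Still c c′ u
      still {u} cu uu = still-but q ch cu (λ { refl → K-U kh uu }) uu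

    -- Two levels down only activity matters, and `y` was active before. The exception is a
    -- grandchild below a 4-child of a centre, whose colour is recorded; the premise on `e ≡ y`
    -- excludes it.
    inv-deep : e ≼ y → Child y h → Child h z → ¬ Inactive c y →
      (e ≡ y → ∀ {u w x} → Centre z u w x → ¬ Four h) → Inv c z → Inv c′ z
    inv-deep {y} {h} {z} q cy ch na hot = inv-calm (step-ext st) (off st λ { refl → acyclic ch (up q cy) })
      (calm-but (up q cy) ch (calmAt-deep q cy na))
      λ C → still C (Centre.four₁ C) (Kids.kid₁ (Centre.kids C)) , still C (Centre.four₂ C) (Kids.kid₂ (Centre.kids C))
      where
      still : Centre z s t x → Four u → Child u z → Still c c′ u
      still {u = u} C fu cu uu {k} ck = off st λ eq → lem eq (u ≟ h)
        where
        lem : k ≡ e → Dec (u ≡ h) → ⊥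
        lem refl (yes refl) = hot (same-parent ck cy q) C fu
        lem refl (no ne) = ne (branch cu ch (up self ck) (up q cy))

    touch : Inactive c h → e ≼ h → Tight c′ h
    touch a self = col (_ , after st)
    touch {h} a (up {h = y} q ch) = one (U-off (λ { refl → acyclic ch q }) (a self) , y ,
      λ ch′ ne → inact-off (λ q′ → ne (branch ch′ ch q′ q)) (inact-≼ a (up self ch′)))

    claim-calm : Child h e → CalmAt c c′ h
    claim-calm ch = calmAt-off (acyclic ch)

    claim-still : Child h e → Still c c′ h
    claim-still ch _ ck = off st λ { refl → acyclic ch (up self ck) }

  waiting-plain : Plain z → Four z → Coloured c z → (Child h z) → (∀ {k} → Child k z → k ≢ h → Inactive c k) →
    Tight c h → PlainInv c z
  locate : Kids z i j k → Child h z → ∃ λ a → ∃ λ b → Kids z h a b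
  locate ks ch with Kids.only ks ch
  ... | inj₁ refl = _ , _ , ks
  ... | inj₂ (inj₁ refl) = _ , _ , swap₁₂ ks
  ... | inj₂ (inj₂ refl) = _ , _ , swap₁₃ ks

  four-kids : Four z → Child h z → ∃ λ a → ∃ λ b → Kids z h a b
  four-kids fz ch with kids fz
  ... | _ , _ , _ , ks = locate ks ch

  waiting-plain pl fz kz ch oth a with four-kids fz ch
  ... | _ , _ , ks = s₁ ks (act-soft a) (inact (oth kid₂ (≢-sym ≢₁₂))) (soft (inact (oth kid₃ (≢-sym ≢₁₃))))
    where open Kids ks

  tame-inact : Inactive c u → Tame c z u
  tame-inact a ch ck = ⊥-elim (just≢nothing ck (a (up self ch)))

  notSame-inact : Inactive c w → NotSame c z u w
  notSame-inact a _ _ _ ch _ ck = ⊥-elim (just≢nothing ck (a (up self ch)))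

  notSame-col : Coloured c u → NotSame c z u w
  notSame-col a b = ⊥-elim (K-U a b)

  notSame-tame : Tame c z u → NotSame c z u w
  notSame-tame t _ _ ch _ ck _ = t ch ck

  notSame-sym : NotSame c z u w → NotSame c z w u
  notSame-sym ns a b p q r s = ns b a q p s r

  mild-inact : Inactive c u → Mild c z u
  mild-inact a = tame (inact-one a) (tame-inact a)

  act-inact : Inactive c u → Tight c u
  act-inact a = one (inact-one a)

  -- Only one child is active while `z` waits, so the colour of `z` is irrelevant. At a centre the
  -- position of the active child selects the case: `third` for a 4-child, `mild` or `lone` for `x`.
  claim : Step c c′ z α → Four z → Inv c z → Inv c′ z
  claim {c} {c′} {z} st fz (plain p a b) = ⊥-elim (K-U a (before st))
  claim {c} {c′} {z} st fz (centre C s b) = centre C (Safe-ext (step-ext st) s)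
    (centre-calm C (step-ext st) (claim-calm st) (claim-still st kid₁) (claim-still st kid₂) b)
    where open Kids (Centre.kids C)
  claim {c} {c′} {z} st fz (wait (waiting {h = h} uz ch oth a)) with kind fz
  ... | inj₁ pl = plain pl (_ , after st) (waiting-plain pl fz (_ , after st) ch
                    (λ ck ne → Inact-calm (claim-calm st ck) (oth ck ne)) (Act-calm (claim-calm st ch) a))
  ... | inj₂ (u , w , x , C) = go (Kids.only (Centre.kids C) ch)
    where
    safe : Safe c′ z
    safe = inj₁ (_ , after st)
    rest : Child k z → k ≢ h → Inactive c′ k
    rest ck ne = Inact-calm (claim-calm st ck) (oth ck ne)
    act : Tight c′ h
    act = Act-calm (claim-calm st ch) a
    side : Centre z u w x → h ≡ u → Inv c′ z
    side C refl = centre C safe (third (inact (rest kid₃ (≢-sym ≢₁₃))) act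
      (act-inact (rest kid₂ (≢-sym ≢₁₂))) (notSame-inact (rest kid₂ (≢-sym ≢₁₂))))
      where open Kids (Centre.kids C)
    go : h ≡ u ⊎ h ≡ w ⊎ h ≡ x → Inv c′ z
    go (inj₁ eq) = side C eq
    go (inj₂ (inj₁ refl)) = centre (mirror C) safe (third (inact (rest kid₃ (≢-sym ≢₂₃))) act
      (act-inact (rest kid₁ ≢₁₂)) (notSame-inact (rest kid₁ ≢₁₂)))
      where open Kids (Centre.kids C)
    go (inj₂ (inj₂ refl)) with act
    ... | col kh = centre C safe (mild kh (mild-inact (rest kid₁ ≢₁₃)) (mild-inact (rest kid₂ ≢₂₃)))
      where open Kids (Centre.kids C)
    ... | one (uh , _) = centre C safe (lone (rest kid₁ ≢₁₃) (rest kid₂ ≢₂₃) uh)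
      where open Kids (Centre.kids C)

  inact-waiting : Four z → Inactive c z → Waiting c z
  inact-waiting fz a with kids fz
  ... | _ , _ , _ , ks = waiting (a self) kid₁ (λ ck _ → inact-≼ a (up self ck)) (act-inact (inact-≼ a (up self kid₁)))
    where open Kids ks

  fresh : Step c c′ e α → Four z → Inactive c z → e ≼ z → Inv c′ z
  fresh st fz a self = claim st fz (wait (inact-waiting fz a))
  fresh st fz a (up {h = h} q ch) = wait (waiting (U-off st (λ { refl → acyclic ch q }) (a self)) ch
    (λ ck ne → inact-off st (λ q′ → ne (branch ck ch q′ q)) (inact-≼ a (up self ck)))
    (touch st (inact-≼ a (up self ch)) q))

  -- Where the way up from `e` enters the active part: never, at `e` itself, or at `f` just above
  -- the last inactive edge `h`.
  data Join (c : Col) (e : Edge) : Set where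
    none : (∀ {z} → e ≼ z → Inactive c z) → Join c e
    wild : ¬ Inactive c e → Join c e
    meet : e ≼ h → Inactive c h → Child h f → ¬ Inactive c f → Join c e

  join : ∀ (c : Col) e → Join c e
  join c e with inact? c e
  ... | no na = wild na
  ... | yes a = go (suc (depth e)) e ≤-refl self a
    where
    go : ∀ n h → depth h < n → e ≼ h → Inactive c h → Join c e
    go (suc n) h (s≤s b) q a with par h in eq
    ... | nothing = none λ {z} q′ → case ≼-total q q′ of λ
          { (inj₁ r) → case climb r of λ { (inj₁ refl) → a ; (inj₂ (_ , r′ , _)) → ⊥-elim (just≢nothing r′ eq) }
          ; (inj₂ r) → inact-≼ a r }
    ... | just f with inact? c f
    ...   | no na = meet q a eq na
    ...   | yes a′ = go n f (<-≤-trans (par-depth eq) b) (up q eq) a′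

  -- Bounding the number of colours that a blank edge sees

  Nb : Edge → Edge → Set
  Nb e f = Up e f ⊎ Child f e

  -- A coloured neighbour outside `L` repeats a colour of `L`, so at most `n` different colours are
  -- seen. Edges of `L` may be blank.
  Covers : ℕ → Col → Edge → Set
  Covers n c e = Σ (List Edge) λ L → length L ≤ n ×
    (∀ {f} → Nb e f → Blank c f ⊎ f ∈ L ⊎ ∃ λ α → ∃ λ s → c f ≡ just α × s ∈ L × c s ≡ just α)

  -- Unlike Covers, this survives all later moves.
  Fixed : Col → Edge → Set
  Fixed c e = Σ (List Edge) λ L → length L ≤ 4 ×
    (∀ {f} → Nb e f → f ∈ L ⊎ ∃ λ α → ∃ λ s → c f ≡ just α × s ∈ L × c s ≡ just α)

  -- Three leave space for one more move of Bob before Alice reacts; a permanent bound of four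
  -- serves as well with five colours.
  Room : Col → Edge → Set
  Room c e = Covers 3 c e ⊎ Fixed c e

  room-covers : Room c e → Covers 4 c e
  room-covers (inj₁ (L , a , b)) = L , m≤n⇒m≤1+n a , b
  room-covers (inj₂ (L , a , b)) = L , a , λ q → inj₂ (b q)

  room-step : Step c c′ g α → Room c e → Covers 4 c′ e
  room-step {g = g} st (inj₁ (L , a , b)) = g ∷ L , s≤s a , λ {f} nb → case f ≟ g of λ
    { (yes refl) → inj₂ (inj₁ (here refl))
    ; (no ne) → case b nb of λ
      { (inj₁ x) → inj₁ (U-off st ne x)
      ; (inj₂ (inj₁ x)) → inj₂ (inj₁ (there x))
      ; (inj₂ (inj₂ (α , s , p , q , r))) → inj₂ (inj₂ (α , s , step-ext st p , there q , step-ext st r)) } }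
  room-step st (inj₂ (L , a , b)) = L , a , λ {f} nb → case b nb of λ
      { (inj₁ x) → inj₂ (inj₁ x)
      ; (inj₂ (α , s , p , q , r)) → inj₂ (inj₂ (α , s , step-ext st p , q , step-ext st r)) }

  palette : ∀ (c : Col) L → Σ (List (Fin 5)) λ l → length l ≤ length L × (∀ {s α} → s ∈ L → c s ≡ just α → α ∈ l)
  palette c [] = [] , z≤n , λ ()
  palette c (s ∷ L) with palette c L | c s in eq
  ... | l , a , b | nothing = l , m≤n⇒m≤1+n a , λ { (here refl) r → ⊥-elim (just≢nothing r eq) ; (there q) r → b q r }
  ... | l , a , b | just α = α ∷ l , s≤s a ,
        λ { (here refl) r → here (just-injective (trans (sym r) eq)) ; (there q) r → there (b q r) }

  covers-legal : Covers 4 c e → Blank c e → ∃ λ α → Legal G c e α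
  covers-legal {c} {e} (L , a , b) ue with palette c L
  ... | l , a′ , b′ with fresh-colour l (≤-trans a′ a)
  ...   | α , α∉ = α , ue , λ f adj cf → case b (adjacent adj) of λ
          { (inj₁ x) → just≢nothing cf x
          ; (inj₂ (inj₁ x)) → α∉ (b′ x cf)
          ; (inj₂ (inj₂ (β , s , p , q , r))) → α∉ (subst (_∈ l) (just-injective (trans (sym p) cf)) (b′ q r)) }

  Open : Col → Set
  Open c = ∀ {e} → Blank c e → ∃ λ α → Legal G c e α

  open-unblocked : Open c → ¬ Blocked G c
  open-unblocked op (e , ue , no-α) = let (α , l) = op ue in no-α α l

  legal-at : Blank c e → (∀ {f} → Nb e f → c f ≢ just α) → Legal G c e α
  legal-at ue nb = ue , λ f adj → nb (adjacent adj)

  kid-up : Kids z i j k → Up i f → f ≡ z ⊎ f ≡ j ⊎ f ≡ k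
  kid-up ks (inj₂ p) = inj₁ (just-injective (trans (sym p) (Kids.kid₁ ks)))
  kid-up ks (inj₁ (ne , p)) with Kids.only ks (trans p (Kids.kid₁ ks))
  ... | inj₁ refl = ⊥-elim (ne refl)
  ... | inj₂ r = inj₂ r

  star-kids : Kids z i j k → Blank c i → Star z s → c s ≡ just α → s ≡ z ⊎ s ≡ j ⊎ s ≡ k
  star-kids ks ui (inj₁ r) cs = inj₁ r
  star-kids ks ui (inj₂ ch) cs with Kids.only ks ch
  ... | inj₁ refl = ⊥-elim (just≢nothing cs ui)
  ... | inj₂ r = inj₂ r

  pick₃ : f ≡ z ⊎ f ≡ j ⊎ f ≡ k → f ∈ z ∷ j ∷ k ∷ []
  pick₃ (inj₁ refl) = here refl
  pick₃ (inj₂ (inj₁ refl)) = there (here refl)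
  pick₃ (inj₂ (inj₂ refl)) = there (there (here refl))

  pick₄ : f ≡ z ⊎ f ≡ j ⊎ f ≡ k → f ∈ z ∷ j ∷ k ∷ y ∷ []
  pick₄ (inj₁ refl) = here refl
  pick₄ (inj₂ (inj₁ refl)) = there (here refl)
  pick₄ (inj₂ (inj₂ refl)) = there (there (here refl))

  room-dead : Kids z i j k → Dead c z i → Room c i
  room-dead {z} {i} {j} {k} {c} ks (_ , ui , y , sh) = inj₂ (z ∷ j ∷ k ∷ y ∷ [] , ≤-refl , go)
    where
    go : ∀ {f} → Nb i f → f ∈ _ ⊎ ∃ λ α → ∃ λ s → c f ≡ just α × s ∈ _ × c s ≡ just α
    go (inj₁ u) = inj₁ (pick₄ (kid-up ks u))
    go {f} (inj₂ ch) with f ≟ y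
    ... | yes refl = inj₁ (there (there (there (here refl))))
    ... | no ne with sh ch ne
    ...   | α , cf , s , ss , cs = inj₂ (α , s , cf , pick₄ (star-kids ks ui ss cs) , cs)

  room-inact : Kids z i j k → Inactive c i → Room c i
  room-inact ks a = inj₁ (_ , ≤-refl , λ
    { (inj₁ u) → inj₂ (inj₁ (pick₃ (kid-up ks u))) ; (inj₂ ch) → inj₁ (a (up self ch)) })

  room-one : Kids z i j k → OneActive c i → Blank c j → Room c i
  room-one {z} {i} {j} {k} {c} ks (_ , y , b) uj = inj₁ (z ∷ k ∷ y ∷ [] , ≤-refl , go)
    where
    go : ∀ {f} → Nb i f → Blank c f ⊎ f ∈ _ ⊎ ∃ λ α → ∃ λ s → c f ≡ just α × s ∈ _ × c s ≡ just α
    go (inj₁ u) with kid-up ks u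
    ... | inj₁ refl = inj₂ (inj₁ (here refl))
    ... | inj₂ (inj₁ refl) = inj₁ uj
    ... | inj₂ (inj₂ refl) = inj₂ (inj₁ (there (here refl)))
    go {f} (inj₂ ch) with f ≟ y
    ... | yes refl = inj₂ (inj₁ (there (there (here refl))))
    ... | no ne = inj₁ (b ch ne self)

  room-narrow : Kids z i j k → ¬ Four i → Blank c j → Blank c k → Room c i
  room-narrow {z} {i} {j} {k} {c} ks nf uj uk with narrow nf
  ... | y , y′ , o = inj₁ (z ∷ y ∷ y′ ∷ [] , ≤-refl , go)
    where
    go : ∀ {f} → Nb i f → Blank c f ⊎ f ∈ _ ⊎ ∃ λ α → ∃ λ s → c f ≡ just α × s ∈ _ × c s ≡ just α
    go (inj₁ u) with kid-up ks u
    ... | inj₁ refl = inj₂ (inj₁ (here refl))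
    ... | inj₂ (inj₁ refl) = inj₁ uj
    ... | inj₂ (inj₂ refl) = inj₁ uk
    go (inj₂ ch) = inj₂ (inj₁ (pick₃ (inj₂ (o ch))))

  room-tame : Kids z i j k → Blank c i → Tame c z i → Room c i
  room-tame {z} {i} {j} {k} {c} ks ui t = inj₁ (z ∷ j ∷ k ∷ [] , ≤-refl , go)
    where
    go : ∀ {f} → Nb i f → Blank c f ⊎ f ∈ _ ⊎ ∃ λ α → ∃ λ s → c f ≡ just α × s ∈ _ × c s ≡ just α
    go (inj₁ u) = inj₂ (inj₁ (pick₃ (kid-up ks u)))
    go {f} (inj₂ ch) with K⊎U c f
    ... | inj₂ uf = inj₁ uf
    ... | inj₁ (α , cf) with t ch cf
    ...   | s , ss , cs = inj₂ (inj₂ (α , s , cf , pick₃ (star-kids ks ui ss cs) , cs))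

  room-soft : Kids z i j k → Blank c i → Soft c z i → Blank c j → Room c i
  room-soft ks ui (col a) uj = ⊥-elim (K-U a ui)
  room-soft ks ui (one a) uj = room-one ks a uj
  room-soft ks ui (dead a) uj = room-dead ks a

  room-quiet : Kids z i j k → Quiet c z i → Room c i
  room-quiet ks (dead a) = room-dead ks a
  room-quiet ks (inact a) = room-inact ks a

  room-act : Kids z i j k → Blank c i → Tight c i → Blank c j → Room c i
  room-act ks ui a = room-soft ks ui (act-soft a)

  room-mild : Kids z i j k → Blank c i → Mild c z i → Room c i
  room-mild ks ui (col a) = ⊥-elim (K-U a ui)
  room-mild ks ui (tame _ t) = room-tame ks ui t

  room-plain : PlainInv c z → Child e z → Blank c e → Room c e
  room-plain (done a) ch ue = ⊥-elim (K-U (a ch) ue)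
  room-plain (s₁ ks a b d) ch ue with Kids.only ks ch
  ... | inj₁ refl = room-soft ks ue a (quiet-U b)
  ... | inj₂ (inj₁ refl) = room-quiet (swap₁₂ ks) b
  ... | inj₂ (inj₂ refl) = room-soft (swap₁₃ ks) ue d (quiet-U b)
  room-plain (s₂ ks nf a b d) ch ue with Kids.only ks ch
  ... | inj₁ refl = room-narrow ks nf (quiet-U b) (quiet-U d)
  ... | inj₂ (inj₁ refl) = room-quiet (swap₁₂ ks) b
  ... | inj₂ (inj₂ refl) = room-quiet (swap₁₃ ks) d

  room-centre : Centre z u w x → CentreInv c z u w x → Child e z → Blank c e → Room c e
  room-centre {z} {u} {w} {x} C b ch ue with Kids.only (Centre.kids C) ch | b
  ... | inj₁ refl | mild _ a _ = room-mild (Centre.kids C) ue a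
  ... | inj₁ refl | third a b _ _ = room-act (swap₂₃ (Centre.kids C)) ue b (quiet-U a)
  ... | inj₁ refl | half a _ _ = ⊥-elim (K-U a ue)
  ... | inj₁ refl | both a b _ _ = room-one (Centre.kids C) a (b self)
  ... | inj₁ refl | lone a _ _ = room-inact (Centre.kids C) a
  ... | inj₂ (inj₁ refl) | mild _ _ a = room-mild (swap₁₂ (Centre.kids C)) ue a
  ... | inj₂ (inj₁ refl) | third a _ b _ = room-act (swap₂₃ (swap₁₂ (Centre.kids C))) ue b (quiet-U a)
  ... | inj₂ (inj₁ refl) | half _ a _ = room-inact (swap₁₂ (Centre.kids C)) a
  ... | inj₂ (inj₁ refl) | both _ a _ _ = room-inact (swap₁₂ (Centre.kids C)) a
  ... | inj₂ (inj₁ refl) | lone _ a _ = room-inact (swap₁₂ (Centre.kids C)) a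
  ... | inj₂ (inj₂ refl) | mild a _ _ = ⊥-elim (K-U a ue)
  ... | inj₂ (inj₂ refl) | third a _ _ _ = room-quiet (swap₁₃ (Centre.kids C)) a
  ... | inj₂ (inj₂ refl) | half _ b a = room-one (swap₁₃ (Centre.kids C)) a (b self) 
  ... | inj₂ (inj₂ refl) | both _ b a _ = room-one (swap₁₃ (Centre.kids C)) a (b self)
  ... | inj₂ (inj₂ refl) | lone a b _ = room-narrow (swap₁₃ (Centre.kids C)) (Centre.narrow₃ C) (b self) (a self)

  room-kid : Four z → Inv c z → Child e z → Blank c e → Room c e
  room-kid {e = e} fz (wait (waiting {h = h} uz ch oth a)) ce ue with four-kids fz ce | e ≟ h
  ... | _ , _ , ks | yes refl = room-act ks ue a (oth (Kids.kid₂ ks) (≢-sym (Kids.≢₁₂ ks)) self)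
  ... | _ , _ , ks | no ne = room-inact ks (oth ce ne)
  room-kid fz (plain _ _ b) ce ue = room-plain b ce ue
  room-kid fz (centre C _ b) ce ue = room-centre C b ce ue

  TwoUp : Edge → Set
  TwoUp e = ∃ λ a → ∃ λ b → ∀ {t} → Up e t → t ≡ a ⊎ t ≡ b

  two-up : Child e p → ¬ Four p → TwoUp e
  two-up {e} {p} ch nf with narrow nf
  ... | y , y′ , o with o ch
  ...   | inj₁ refl = p , y′ , λ
          { (inj₁ (ne , q)) → case o (trans q ch) of λ { (inj₁ r) → ⊥-elim (ne r) ; (inj₂ r) → inj₂ r }
          ; (inj₂ q) → inj₁ (just-injective (trans (sym q) ch)) }
  ...   | inj₂ refl = p , y , λ
          { (inj₁ (ne , q)) → case o (trans q ch) of λ { (inj₂ r) → ⊥-elim (ne r) ; (inj₁ r) → inj₂ r }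
          ; (inj₂ q) → inj₁ (just-injective (trans (sym q) ch)) }

  top-view : ∀ e → TwoUp e ⊎ ∃ λ z → Child e z × Four z
  top-view e = go (par e) refl
    where
    go : ∀ v → par e ≡ v → TwoUp e ⊎ ∃ λ z → Child e z × Four z
    go nothing eq = inj₁ (roots eq)
    go (just z) eq with four? z
    ... | yes fz = inj₂ (z , eq , fz)
    ... | no nf = inj₁ (two-up eq nf)

  -- Two neighbours lie above. A narrow lower end adds two more, a waiting star only its one active
  -- child. A blank centre has all three children to count, but `Safe` gives one of the upper
  -- neighbours the colour of a child.
  room-top : TwoUp e → (Four e → Inv c e) → Blank c e → Room c e
  room-top {e} {c} (a , b , o) inv ue with four? e
  ... | no nf with narrow nf
  ...   | y , y′ , o′ = inj₂ (a ∷ b ∷ y ∷ y′ ∷ [] , ≤-refl , λ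
          { (inj₁ u) → case o u of λ { (inj₁ refl) → inj₁ (here refl) ; (inj₂ refl) → inj₁ (there (here refl)) }
          ; (inj₂ ch) → case o′ ch of λ { (inj₁ refl) → inj₁ (there (there (here refl)))
                                        ; (inj₂ refl) → inj₁ (there (there (there (here refl)))) } })
  room-top {e} {c} (a , b , o) inv ue | yes fe with inv fe
  ... | plain _ k _ = ⊥-elim (K-U k ue)
  ... | wait (waiting {h = h} _ ch oth _) = inj₁ (a ∷ b ∷ h ∷ [] , ≤-refl , go)
    where
    go : ∀ {f} → Nb e f → Blank c f ⊎ f ∈ _ ⊎ ∃ λ α → ∃ λ s → c f ≡ just α × s ∈ _ × c s ≡ just α
    go (inj₁ u) with o u
    ... | inj₁ refl = inj₂ (inj₁ (here refl))
    ... | inj₂ refl = inj₂ (inj₁ (there (here refl)))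
    go {f} (inj₂ cf) with f ≟ h
    ... | yes refl = inj₂ (inj₁ (there (there (here refl))))
    ... | no ne = inj₁ (oth cf ne self)
  ... | centre _ (inj₁ k) _ = ⊥-elim (K-U k ue)
  ... | centre {u} {w} {x} C (inj₂ (s , t , d , cs , ut , p , q)) _ with o ut
  ...   | inj₁ refl = inj₂ (b ∷ u ∷ w ∷ x ∷ [] , ≤-refl , go)
    where
    kid : Child f e → f ∈ b ∷ u ∷ w ∷ x ∷ []
    kid ch = there (pick₃ (Kids.only (Centre.kids C) ch))
    go : ∀ {f} → Nb e f → f ∈ _ ⊎ ∃ λ α → ∃ λ s → c f ≡ just α × s ∈ _ × c s ≡ just α
    go (inj₁ u′) with o u′
    ... | inj₁ refl = inj₂ (d , s , q , kid cs , p)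
    ... | inj₂ refl = inj₁ (here refl)
    go (inj₂ cf) = inj₁ (kid cf)
  ...   | inj₂ refl = inj₂ (a ∷ u ∷ w ∷ x ∷ [] , ≤-refl , go)
    where
    kid : Child f e → f ∈ a ∷ u ∷ w ∷ x ∷ []
    kid ch = there (pick₃ (Kids.only (Centre.kids C) ch))
    go : ∀ {f} → Nb e f → f ∈ _ ⊎ ∃ λ α → ∃ λ s → c f ≡ just α × s ∈ _ × c s ≡ just α
    go (inj₁ u′) with o u′
    ... | inj₂ refl = inj₂ (d , s , q , kid cs , p)
    ... | inj₁ refl = inj₁ (here refl)
    go (inj₂ cf) = inj₁ (kid cf)

  room : AllInv c → Blank c e → Room c e
  room {e = e} inv ue with top-view e
  ... | inj₁ two = room-top two inv ue
  ... | inj₂ (z , ch , fz) = room-kid fz (inv fz) ch ue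

  inv-open : AllInv c → Open c
  inv-open inv ue = covers-legal (room-covers (room inv ue)) ue

  -- `Room` is made to survive one move, so no edge is blocked after Bob's move although the
  -- invariant may fail there.
  step-open : AllInv c → Step c c′ g α → Open c′
  step-open inv st ue = covers-legal (room-step st (room inv (U-back st ue))) ue

-- Alice's answers at a damaged star

module Replies (G : Graph) (R : Rooted G) where
  open Graph G using (m)
  open Play G R
  open Steps G R

  private variable
    c c′ c″ : Col
    e f g h i j k p s t u w x y z : Edge
    α β d : Fin 5

  -- A reply strays from the star of `z` at most to an inactive edge below a narrow child; this
  -- keeps all other stars intact, see `spot-others`.
  data Spot (c : Col) (z e : Edge) : Set where
    kid : Child e z → Spot c z e
    outer : Child e x → Child x z → ¬ Four x → Inactive c e → Spot c z e

  Reply : Col → Edge → Set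
  Reply c z = ∃ λ e → ∃ λ α → Legal G c e α × Spot c z e × (∀ {c′} → Step c c′ e α → Inv c′ z)

  Answer : Col → Edge → Set
  Answer c z = Reply c z ⊎ (∀ {h} → Child h z → Coloured c h)

  all-kids : Kids z i j k → Coloured c i → Coloured c j → Coloured c k → ∀ {h} → Child h z → Coloured c h
  all-kids ks a b d ch with Kids.only ks ch
  ... | inj₁ refl = a
  ... | inj₂ (inj₁ refl) = b
  ... | inj₂ (inj₂ refl) = d

  module _ (st : Step c c′ h α) (ch : Child h z) where
    kid-calm : Child s z → s ≢ h → CalmAt c c′ s
    kid-calm cs ne = calmAt-off st λ q → ne (sym (same-parent ch cs q))

    kid-still : Child s z → s ≢ h → Still c c′ s
    kid-still = still-but st self ch

  module _ (st : Step c c′ y α) (cy : Child y x) (cx : Child x z) where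
    outer-calm : Child s z → s ≢ x → CalmAt c c′ s
    outer-calm cs ne = calmAt-off st λ q → ne (branch cs cx q (up self cy))

    outer-still : Child s z → s ≢ x → Still c c′ s
    outer-still = still-but st (up self cy) cx

  colour-kid : Open c → Blank c h → Child h z → (∀ {α c′} → Step c c′ h α → Inv c′ z) → Reply c z
  colour-kid op uh ch inv with op uh
  ... | α , l = _ , α , l , kid ch , inv

  narrow-dead : ¬ Four x → Blank c x → Child y x → c y ≡ just α → InZ c z α → Dead c z x
  narrow-dead {x} {y = y} nf ux cy ye iz with narrow nf
  ... | y₁ , y₂ , two with two cy
  ...   | inj₁ refl = nf , ux , y₂ , λ ch ne → case two ch of λ
          { (inj₁ refl) → _ , ye , iz ; (inj₂ r) → ⊥-elim (ne r) }
  ...   | inj₂ refl = nf , ux , y₁ , λ ch ne → case two ch of λ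
          { (inj₁ r) → ⊥-elim (ne r) ; (inj₂ refl) → _ , ye , iz }

  Kill : Col → Edge → Edge → Set
  Kill c z x = ∃ λ y → ∃ λ α → Child y x × Inactive c y × Legal G c y α ×
    (∀ {c′} → Step c c′ y α → Dead c′ z x)

  -- A child `f` of `x` other than `y₀` can take `α`: everything below it is blank and so is `x`.
  -- Only its sibling could already carry `α`, and in that case `x` is dead without a move.
  kill : InZ c z α → Child x z → ¬ Four x → OneActive c x → Dead c z x ⊎ Kill c z x
  kill {c} {z} {α} {x} a cx nf (ux , y₀ , oth) with narrow nf
  ... | y₁ , y₂ , two = go (new? y₁) (new? y₂)
    where
    New : Edge → Set
    New f = Child f x × f ≢ y₀
    new? : ∀ f → Dec (New f)
    new? f = child? f x ×-dec ¬? (f ≟ y₀)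
    try : ∀ f o → (∀ {g} → Child g x → g ≡ f ⊎ g ≡ o) → New f → Dead c z x ⊎ Kill c z x
    try f o two (cf , nef) with child? o x ×-dec has? c o α
    ... | yes (co , ho) = inj₁ (nf , ux , f , λ ch ne → case two ch of λ
          { (inj₁ r) → ⊥-elim (ne r) ; (inj₂ refl) → α , ho , a })
    ... | no ¬o = inj₂ (f , α , cf , oth cf nef , legal-at (oth cf nef self) legal , λ st →
          nf , U-off st (λ { refl → acyclic cf self }) ux , o , λ ch ne → case two ch of λ
            { (inj₁ refl) → α , after st , InZ-ext (step-ext st) a ; (inj₂ r) → ⊥-elim (ne r) })
      where
      legal : ∀ {g} → Nb f g → c g ≢ just α
      legal (inj₂ ch) cg = just≢nothing cg (oth cf nef (up self ch))
      legal (inj₁ (inj₂ q)) cg with just-injective (trans (sym q) cf)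
      ... | refl = just≢nothing cg ux
      legal (inj₁ (inj₁ (ne , q))) cg with two (trans q cf)
      ... | inj₁ r = ne r
      ... | inj₂ refl = ¬o (trans q cf , cg)
    go : Dec (New y₁) → Dec (New y₂) → Dead c z x ⊎ Kill c z x
    go (yes n₁) _ = try y₁ y₂ two n₁
    go (no _) (yes n₂) = try y₂ y₁ (λ ch → [ inj₂ , inj₁ ]′ (two ch)) n₂
    -- `y₀` is the only possible child of `x`, so nothing has to be repeated.
    go (no ¬n₁) (no ¬n₂) = inj₁ (nf , ux , y₀ , λ ch ne → case two ch of λ
      { (inj₁ refl) → ⊥-elim (¬n₁ (ch , ne)) ; (inj₂ refl) → ⊥-elim (¬n₂ (ch , ne)) })

  -- Bob spoils one child. In `t₁` a quiet child may be gone; in `t₂` the activity below `i` is out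
  -- of control, but `i` is narrow and is coloured at once.
  data PlainTurn (c : Col) (z : Edge) : Set where
    t₁ : Kids z i j k → Soft c z i → Soft c z j → Soft c z k → PlainTurn c z
    t₂ : Kids z i j k → ¬ Four i → Blank c i → Soft c z j → Quiet c z k → PlainTurn c z

  plain-turn : Four z → PlainInv c z → PlainTurn c z
  plain-turn fz (done a) with kids fz
  ... | _ , _ , _ , ks = t₁ ks (col (a (Kids.kid₁ ks))) (col (a (Kids.kid₂ ks))) (col (a (Kids.kid₃ ks)))
  plain-turn fz (s₁ ks a b d) = t₁ ks a (soft b) d
  plain-turn fz (s₂ ks nf a b d) = t₂ ks nf a (soft b) d

  module PlainReply (pl : Plain z) (kz : Coloured c z) (op : Open c) where

    inv : ∀ {c′} → Ext c c′ → PlainInv c′ z → Inv c′ z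
    inv ex = plain pl (proj₁ kz , ex (proj₂ kz))

    -- The quiet child protects the other two while it is blank, so it is coloured after them.
    with-quiet : Kids z i j k → Soft c z i → Quiet c z j → Soft c z k → Answer c z
    with-quiet {i} {j} {k} ks a b d with K⊎U c i | K⊎U c k
    ... | inj₂ ui | _ = inj₁ (colour-kid op ui kid₁ λ st → inv (step-ext st)
          (s₁ ks (col (_ , after st)) (Quiet-calm (step-ext st) (kid-calm st kid₁ kid₂ (≢-sym ≢₁₂)) b)
                 (Soft-calm (step-ext st) (kid-calm st kid₁ kid₃ (≢-sym ≢₁₃)) d)))
      where open Kids ks
    ... | inj₁ _ | inj₂ uk = inj₁ (colour-kid op uk kid₃ λ st → inv (step-ext st)
          (s₁ ks (Soft-calm (step-ext st) (kid-calm st kid₃ kid₁ ≢₁₃) a)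
                 (Quiet-calm (step-ext st) (kid-calm st kid₃ kid₂ ≢₂₃) b) (col (_ , after st))))
      where open Kids ks
    ... | inj₁ ki | inj₁ kk = inj₁ (colour-kid op (quiet-U b) kid₂ λ st → inv (step-ext st)
          (done (all-kids ks (K-calm (kid-calm st kid₂ kid₁ ≢₁₂) ki) (_ , after st)
                             (K-calm (kid-calm st kid₂ kid₃ (≢-sym ≢₂₃)) kk))))
      where open Kids ks

    last-one : Kids z i j k → OneActive c i → Coloured c j → Coloured c k → Answer c z
    last-one ks a b d = inj₁ (colour-kid op (proj₁ a) kid₁ λ st → inv (step-ext st)
      (done (all-kids ks (_ , after st) (K-calm (kid-calm st kid₁ kid₂ (≢-sym ≢₁₂)) b)
                         (K-calm (kid-calm st kid₁ kid₃ (≢-sym ≢₁₃)) d))))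
      where open Kids ks

    kill-one : Kids z i j k → ¬ Four i → OneActive c i → Soft c z j → Soft c z k → Answer c z
    kill-one ks nf a b d with kill (z , inj₁ refl , proj₂ kz) (Kids.kid₁ ks) nf a
    ... | inj₁ de = with-quiet (swap₁₂ ks) b (dead de) d
    ... | inj₂ (y , α , cy , ay , l , de) = inj₁ (y , α , l , outer cy kid₁ nf ay , λ st → inv (step-ext st)
          (s₁ (swap₁₂ ks) (Soft-calm (step-ext st) (outer-calm st cy kid₁ kid₂ (≢-sym ≢₁₂)) b) (dead (de st))
                          (Soft-calm (step-ext st) (outer-calm st cy kid₁ kid₃ (≢-sym ≢₁₃)) d)))
      where open Kids ks

    -- One of the two is narrow because the star is plain; making it harmless supplies the quiet
    -- child that is missing.
    two-ones : Kids z i j k → OneActive c i → OneActive c j → Soft c z k → Answer c z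
    two-ones ks a b d with pl (Kids.kid₁ ks) (Kids.kid₂ ks) (Kids.≢₁₂ ks)
    ... | inj₁ nf = kill-one ks nf a (one b) d
    ... | inj₂ nf = kill-one (swap₁₂ ks) nf b (one a) d

    respond : PlainTurn c z → Answer c z
    respond (t₂ ks nf ui a b) = inj₁ (colour-kid op ui kid₁ λ st → inv (step-ext st)
      (s₁ (swap₂₃ ks) (col (_ , after st)) (Quiet-calm (step-ext st) (kid-calm st kid₁ kid₃ (≢-sym ≢₁₃)) b)
                      (Soft-calm (step-ext st) (kid-calm st kid₁ kid₂ (≢-sym ≢₁₂)) a)))
      where open Kids ks
    respond (t₁ ks (dead a) b d) = with-quiet (swap₁₂ ks) b (dead a) d
    respond (t₁ ks a (dead b) d) = with-quiet ks a (dead b) d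
    respond (t₁ ks a b (dead d)) = with-quiet (swap₂₃ ks) a (dead d) b
    respond (t₁ ks (one a) (one b) d) = two-ones ks a b d
    respond (t₁ ks (one a) b (one d)) = two-ones (swap₂₃ ks) a d b
    respond (t₁ ks a (one b) (one d)) = two-ones (swap₁₂ (swap₁₃ ks)) b d a
    respond (t₁ ks (one a) (col b) (col d)) = last-one ks a b d
    respond (t₁ ks (col a) (one b) (col d)) = last-one (swap₁₂ ks) b a d
    respond (t₁ ks (col a) (col b) (one d)) = last-one (swap₁₃ ks) d b a
    respond (t₁ ks (col a) (col b) (col d)) = inj₂ (all-kids ks a b d)

  Fresh : Col → Edge → Set
  Fresh c h = Coloured c h ⊎ Inactive c h

  Only : Col → Edge → Fin 5 → Set
  Only c u d = ∀ {k α} → Child k u → c k ≡ just α → α ≡ d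

  -- Positions that a single move of Bob can produce from `CentreInv`. In `equal`, `NotSame` may be
  -- lost: `u` and `w` can share a colour that is missing from the star.
  data CentreTurn (c : Col) (z u w x : Edge) : Set where
    mend  : Coloured c x → Blank c u → Mild c z w → CentreTurn c z u w x
    split : Coloured c x → Tight c u → Tight c w → NotSame c z u w → CentreTurn c z u w x
    trim  : OneActive c x → Tight c u → Tight c w → NotSame c z u w → CentreTurn c z u w x
    side  : Quiet c z x → Blank c u → Tight c w → CentreTurn c z u w x
    last  : Fresh c u → Fresh c w → Blank c x → CentreTurn c z u w x
    open₁ : Blank c u → Inactive c w → OneActive c x → CentreTurn c z u w x
    equal : OneActive c u → OneActive c w → Blank c x → ¬ InZ c z d → Only c u d → Only c w d →
            (∀ {y} → Child y x → c y ≢ just d) → CentreTurn c z u w x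
    mid   : OneActive c u → Inactive c w → Blank c x → CentreTurn c z u w x

  fresh-mild : Fresh c u → Mild c z u
  fresh-mild (inj₁ a) = col a
  fresh-mild (inj₂ a) = mild-inact a

  anchor : Safe c z → ∃ λ α → InZ c z α
  anchor {z = z} (inj₁ (α , a)) = α , z , inj₁ refl , a
  anchor (inj₂ (s , _ , d , a , _ , b , _)) = d , s , inj₂ a , b

  Hot : Col → Edge → Edge → Fin 5 → Set
  Hot c z u d = ¬ InZ c z d × Only c u d × ∃ λ k → Child k u × c k ≡ just d

  -- At most one child of a `OneActive` edge is coloured, so it contributes at most one colour that
  -- is new to the star.
  hot : ∀ z → OneActive c u → Tame c z u ⊎ ∃ (Hot c z u)
  hot {c} {u} z (uu , y , oth) = go (c y) refl (child? y u)
    where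
    only : ∀ {k α} → Child k u → c k ≡ just α → k ≡ y
    only {k} ch ck with k ≟ y
    ... | yes r = r
    ... | no ne = ⊥-elim (just≢nothing ck (oth ch ne self))
    go : ∀ v → c y ≡ v → Dec (Child y u) → Tame c z u ⊎ ∃ (Hot c z u)
    go nothing eq _ = inj₁ λ ch ck → case only ch ck of λ { refl → ⊥-elim (just≢nothing ck eq) }
    go (just d) eq (no nc) = inj₁ λ ch ck → case only ch ck of λ { refl → ⊥-elim (nc ch) }
    go (just d) eq (yes cy) with inZ? c z d
    ... | yes iz = inj₁ λ ch ck → case only ch ck of λ { refl → subst (InZ c z) (just-injective (trans (sym eq) ck)) iz }
    ... | no niz = inj₂ (d , niz , (λ ch ck → case only ch ck of λ { refl → just-injective (trans (sym ck) eq) }) , y , cy , eq)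

  legal-kid : Child h z → Blank c h → ¬ InZ c z d → (∀ {y} → Child y h → c y ≢ just d) → Legal G c h d
  legal-kid ch uh niz ok = legal-at uh λ
    { (inj₁ (inj₁ (_ , q))) r → niz (_ , inj₂ (trans q ch) , r)
    ; (inj₁ (inj₂ q)) r → niz (_ , inj₁ (just-injective (trans (sym q) ch)) , r)
    ; (inj₂ q) r → ok q r }

  module CentreReply (C : Centre z u w x) (sz : Safe c z) (op : Open c) where
    open Kids (Centre.kids C)
    open Centre C using (narrow₃; four₁; four₂)

    inv : ∀ {c′} → Ext c c′ → CentreInv c′ z u w x → Inv c′ z
    inv ex = centre C (Safe-ext ex sz)

    cut : Coloured c x → OneActive c u → Tight c w → NotSame c z u w → Reply c z
    cut kx ou (col kw) ns = colour-kid op (proj₁ ou) kid₁ λ st → inv (step-ext st)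
      (mild (K-calm (kid-calm st kid₁ kid₃ (≢-sym ≢₁₃)) kx) (col (_ , after st))
            (col (K-calm (kid-calm st kid₁ kid₂ (≢-sym ≢₁₂)) kw)))
    cut kx ou (one ow) ns with hot z ow
    ... | inj₁ t = colour-kid op (proj₁ ou) kid₁ λ st → inv (step-ext st)
          (mild (K-calm (kid-calm st kid₁ kid₃ (≢-sym ≢₁₃)) kx) (col (_ , after st))
                (Mild-calm (step-ext st) (kid-calm st kid₁ kid₂ (≢-sym ≢₁₂)) (kid-still st kid₁ kid₂ (≢-sym ≢₁₂)) (tame ow t)))
    -- The new colour of `w` goes to `u`: it is missing from the star, and `NotSame` keeps it off
    -- the children of `u`.
    ... | inj₂ (d , niz , on , k , ck , kd) = u , d ,
          legal-kid kid₁ (proj₁ ou) niz (λ cy r → niz (ns (proj₁ ou) (proj₁ ow) cy ck r kd)) , kid kid₁ , λ st →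
          inv (step-ext st) (mild (K-calm (kid-calm st kid₁ kid₃ (≢-sym ≢₁₃)) kx) (col (_ , after st))
            (tame (One-calm (kid-calm st kid₁ kid₂ (≢-sym ≢₁₂)) ow)
              λ ch r → u , inj₂ kid₁ , trans (after st) (cong just (sym (on ch (trans (sym (kid-still st kid₁ kid₂ (≢-sym ≢₁₂) (proj₁ ow) ch)) r))))))

    mend-reply : Coloured c x → Blank c u → Mild c z w → Reply c z
    mend-reply kx uu mw = colour-kid op uu kid₁ λ st → inv (step-ext st)
      (mild (K-calm (kid-calm st kid₁ kid₃ (≢-sym ≢₁₃)) kx) (col (_ , after st))
            (Mild-calm (step-ext st) (kid-calm st kid₁ kid₂ (≢-sym ≢₁₂)) (kid-still st kid₁ kid₂ (≢-sym ≢₁₂)) mw))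

    side-reply : Quiet c z x → Blank c u → Tight c w → Reply c z
    side-reply qx uu aw = colour-kid op uu kid₁ λ st → inv (step-ext st)
      (third (Quiet-calm (step-ext st) (kid-calm st kid₁ kid₃ (≢-sym ≢₁₃)) qx) (col (_ , after st))
             (Act-calm (kid-calm st kid₁ kid₂ (≢-sym ≢₁₂)) aw) (notSame-col (_ , after st)))

    last-reply : Mild c z u → Mild c z w → Blank c x → Reply c z
    last-reply mu mw ux = colour-kid op ux kid₃ λ st → inv (step-ext st)
      (mild (_ , after st) (Mild-calm (step-ext st) (kid-calm st kid₃ kid₁ ≢₁₃) (kid-still st kid₃ kid₁ ≢₁₃) mu)
                           (Mild-calm (step-ext st) (kid-calm st kid₃ kid₂ ≢₂₃) (kid-still st kid₃ kid₂ ≢₂₃) mw))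

    open₁-reply : Blank c u → Inactive c w → OneActive c x → Reply c z
    open₁-reply uu aw ox = colour-kid op uu kid₁ λ st → inv (step-ext st)
      (half (_ , after st) (Inact-calm (kid-calm st kid₁ kid₂ (≢-sym ≢₁₂)) aw) (One-calm (kid-calm st kid₁ kid₃ (≢-sym ≢₁₃)) ox))

    -- Giving x the only new colour d of u and w makes both of them tame.
    equal-reply : OneActive c u → OneActive c w → Blank c x → ¬ InZ c z d → Only c u d → Only c w d →
      (∀ {y} → Child y x → c y ≢ just d) → Reply c z
    equal-reply {d} ou ow ux niz onu onw ok = x , d , legal-kid kid₃ ux niz ok , kid kid₃ , λ st →
      inv (step-ext st) (mild (_ , after st)
        (tame (One-calm (kid-calm st kid₃ kid₁ ≢₁₃) ou)
          λ ch r → x , inj₂ kid₃ , trans (after st) (cong just (sym (onu ch (trans (sym (kid-still st kid₃ kid₁ ≢₁₃ (proj₁ ou) ch)) r)))))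
        (tame (One-calm (kid-calm st kid₃ kid₂ ≢₂₃) ow)
          λ ch r → x , inj₂ kid₃ , trans (after st) (cong just (sym (onw ch (trans (sym (kid-still st kid₃ kid₂ ≢₂₃ (proj₁ ow) ch)) r))))))

  module CentreReply₂ (C : Centre z u w x) (sz : Safe c z) (op : Open c) where
    open Kids (Centre.kids C)
    open Centre C using (narrow₃)
    open CentreReply C sz op
    module M = CentreReply (mirror C) sz op

    third-reply : Quiet c z x → Tight c u → Tight c w → Answer c z
    third-reply qx au aw with K⊎U c u | K⊎U c w
    ... | inj₂ uu | _ = inj₁ (side-reply qx uu aw)
    ... | inj₁ _ | inj₂ uw = inj₁ (M.side-reply qx uw au)
    ... | inj₁ ku | inj₁ kw = inj₁ (last-reply (col ku) (col kw) (quiet-U qx))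

    mild-reply : Coloured c x → Mild c z u → Mild c z w → Answer c z
    mild-reply kx mu mw with K⊎U c u | K⊎U c w
    ... | inj₂ uu | _ = inj₁ (mend-reply kx uu mw)
    ... | inj₁ _ | inj₂ uw = inj₁ (M.mend-reply kx uw mu)
    ... | inj₁ ku | inj₁ kw = inj₂ (all-kids (Centre.kids C) ku kw kx)

    trim-reply : OneActive c x → Tight c u → Tight c w → NotSame c z u w → Answer c z
    trim-reply ox au aw ns with kill (proj₂ (anchor sz)) kid₃ narrow₃ ox
    ... | inj₁ de = third-reply (dead de) au aw
    ... | inj₂ (y , α , cy , ay , l , de) = inj₁ (y , α , l , outer cy kid₃ narrow₃ ay , λ st →
          let cu = outer-calm st cy kid₃ kid₁ ≢₁₃ ; cw = outer-calm st cy kid₃ kid₂ ≢₂₃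
              su = outer-still st cy kid₃ kid₁ ≢₁₃ ; sw = outer-still st cy kid₃ kid₂ ≢₂₃ in
          inv (step-ext st) (third (dead (de st)) (Act-calm cu au) (Act-calm cw aw)
            (NotSame-calm (step-ext st) cu cw su sw ns)))

    -- If `x` has a coloured child, repeating that colour in the star makes `x` dead, and the
    -- inactive `w` can take any colour that is missing there. If not, `x` is free to take the new
    -- colour of `u`.
    mid-reply : OneActive c u → Inactive c w → Blank c x → Answer c z
    mid-reply ou aw ux with any? (λ y → child? y x ×-dec ¬? (u? c y))
    ... | yes (y , cy , ny) = go (K⊎U c y)
      where
      go : Coloured c y ⊎ Blank c y → Answer c z
      go (inj₂ uy) = ⊥-elim (ny uy)
      go (inj₁ (e , ye)) with inZ? c z e
      ... | yes iz = third-reply (dead (narrow-dead narrow₃ ux cy ye iz)) (one ou) (act-inact aw)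
      ... | no niz = inj₁ (w , e , legal-kid kid₂ (aw self) niz (λ ch r → just≢nothing r (aw (up self ch))) , kid kid₂ ,
            λ st → inv (step-ext st) (third
              (dead (narrow-dead narrow₃ (U-calm (kid-calm st kid₂ kid₃ (≢-sym ≢₂₃)) ux) cy (step-ext st ye) (w , inj₂ kid₂ , after st)))
              (one (One-calm (kid-calm st kid₂ kid₁ ≢₁₂) ou)) (col (_ , after st)) (notSame-sym (notSame-col (_ , after st)))))
    ... | no ¬busy with hot z ou
    ...   | inj₁ t = inj₁ (last-reply (tame ou t) (mild-inact aw) ux)
    ...   | inj₂ (d , niz , on , _) = inj₁ (equal-reply ou (inact-one aw) ux niz on
              (λ ch r → ⊥-elim (just≢nothing r (aw (up self ch))))
              λ ch r → ¬busy (_ , ch , just≢nothing r))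

    split-reply : Coloured c x → Tight c u → Tight c w → NotSame c z u w → Answer c z
    split-reply kx (col ku) (col kw) ns = inj₂ (all-kids (Centre.kids C) ku kw kx)
    split-reply kx (one ou) aw ns = inj₁ (cut kx ou aw ns)
    split-reply kx (col ku) (one ow) ns = inj₁ (M.cut kx ow (col ku) (notSame-sym ns))

    respond : CentreTurn c z u w x → Answer c z
    respond (mend a b d) = inj₁ (mend-reply a b d)
    respond (split a b d ns) = split-reply a b d ns
    respond (trim a b d ns) = trim-reply a b d ns
    respond (side a b d) = inj₁ (side-reply a b d)
    respond (last a b d) = inj₁ (last-reply (fresh-mild a) (fresh-mild b) d)
    respond (open₁ a b d) = inj₁ (open₁-reply a b d)
    respond (equal a b d f g h i) = inj₁ (equal-reply a b d f g h i)
    respond (mid a b d) = mid-reply a b d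

    respond-inv : CentreInv c z u w x → Answer c z
    respond-inv (mild a b d) = mild-reply a b d
    respond-inv (third a b d _) = third-reply a b d
    respond-inv (half a b d) = inj₁ (last-reply (col a) (mild-inact b) (proj₁ d))
    respond-inv (both a b d _) = inj₁ (open₁-reply (proj₁ a) b d)
    respond-inv (lone a b d) = inj₁ (last-reply (mild-inact a) (mild-inact b) d)

  data Turn (c : Col) (z : Edge) : Set where
    plain : Plain z → Coloured c z → PlainTurn c z → Turn c z
    centre : Centre z u w x → Safe c z → CentreInv c z u w x ⊎ CentreTurn c z u w x → Turn c z

  answer : Open c → Turn c z → Answer c z
  answer op (plain pl kz t) = PlainReply.respond pl kz op t
  answer op (centre C sz (inj₁ t)) = CentreReply₂.respond-inv C sz op t
  answer op (centre C sz (inj₂ t)) = CentreReply₂.respond C sz op t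

-- What Bob's move does to a star, and the repair of a star whose upper edge is blank

module Damage (G : Graph) (R : Rooted G) where
  open Graph G using (m)
  open Play G R
  open Steps G R
  open Replies G R

  private variable
    c c′ c″ : Col
    e f g h i j k p s t u v w x y z : Edge
    α β d : Fin 5

  -- What happens to the child t of a star when Bob colours an edge below or at t.
  data Post (c c′ : Col) (t : Edge) : Set where
    now   : Coloured c′ t → Post c c′ t
    new   : Inactive c t → OneActive c′ t → Post c c′ t
    again : ¬ Inactive c t → Blank c′ t → Post c c′ t

  one-only : OneActive c x → Child y x → Child k x → Coloured c y → Coloured c k → y ≡ k
  one-only {y = y} {k} (_ , o , oth) cy ck ky kk with y ≟ o | k ≟ o
  ... | yes refl | yes refl = refl
  ... | no ne | _ = ⊥-elim (K-U ky (oth cy ne self))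
  ... | _ | no ne = ⊥-elim (K-U kk (oth ck ne self))

  module Touched (st : Step c c′ e α) (q : e ≼ t) (ct : Child t z) (ut : Blank c t) where

    ex : Ext c c′
    ex = step-ext st

    calm : Child s z → s ≢ t → CalmAt c c′ s
    calm cs ne = calmAt-off st λ q′ → ne (branch cs ct q′ q)

    still : Child s z → s ≢ t → Still c c′ s
    still = still-but st q ct

    quiet-post : Quiet c z t → Post c c′ t → Soft c′ z t
    quiet-post _ (now a) = col a
    quiet-post _ (new _ a) = one a
    quiet-post (dead a) (again _ b) = dead (Dead-ext ex b a)
    quiet-post (inact a) (again b _) = ⊥-elim (b a)

    post-U : Post c c′ t → Coloured c′ t ⊎ Blank c′ t
    post-U (now a) = inj₁ a
    post-U (new _ a) = inj₂ (proj₁ a)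
    post-U (again _ a) = inj₂ a

    -- A child whose activity grows becomes the `i` of `t₂` and has to be narrow. For a 4-child
    -- growing activity breaks its own waiting star, and the answer is given there.
    NarrowAgain : Post c c′ t → Set
    NarrowAgain (again _ _) = ¬ Four t
    NarrowAgain _ = ⊤

    plain-soft : Kids z t j k → Quiet c z j → Soft c z k → (po : Post c c′ t) → NarrowAgain po → PlainTurn c′ z
    plain-soft ks b d po na = go po na
      where
      open Kids ks
      b′ = Quiet-calm ex (calm kid₂ (≢-sym ≢₁₂)) b
      d′ = Soft-calm ex (calm kid₃ (≢-sym ≢₁₃)) d
      go : (po : Post c c′ t) → NarrowAgain po → PlainTurn c′ z
      go (now a) _ = t₁ ks (col a) (soft b′) d′
      go (new _ a) _ = t₁ ks (one a) (soft b′) d′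
      go (again _ a) nf = t₂ (swap₂₃ ks) nf a d′ b′

    plain-touch : PlainInv c z → (po : Post c c′ t) → NarrowAgain po → PlainTurn c′ z
    plain-touch (done a) _ _ = ⊥-elim (K-U (a ct) ut)
    plain-touch (s₁ ks a b d) po na with Kids.only ks ct
    ... | inj₁ refl = plain-soft ks b d po na
    ... | inj₂ (inj₁ refl) = t₁ ks (Soft-calm ex (calm kid₁ ≢₁₂) a) (quiet-post b po)
                                   (Soft-calm ex (calm kid₃ (≢-sym ≢₂₃)) d)
      where open Kids ks
    ... | inj₂ (inj₂ refl) = plain-soft (swap₁₃ ks) b a po na
    plain-touch (s₂ ks nf a b d) po na with Kids.only ks ct
    ... | inj₁ refl = plain-soft ks b (soft d) po na
    ... | inj₂ (inj₁ refl) = t₂ ks nf (U-calm (calm kid₁ ≢₁₂) a) (quiet-post b po)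
                                   (Quiet-calm ex (calm kid₃ (≢-sym ≢₂₃)) d)
      where open Kids ks
    ... | inj₂ (inj₂ refl) = t₂ (swap₂₃ ks) nf (U-calm (calm kid₁ ≢₁₃) a) (quiet-post d po)
                                   (Quiet-calm ex (calm kid₂ ≢₂₃) b)
      where open Kids ks

    Result : Edge → Edge → Edge → Set
    Result u w x = CentreInv c′ z u w x ⊎ CentreTurn c′ z u w x

    module _ (C : Centre z t w x) where
      open Kids (Centre.kids C)
      private
        cw = calm kid₂ (≢-sym ≢₁₂)
        cx = calm kid₃ (≢-sym ≢₁₃)
        sw = still kid₂ (≢-sym ≢₁₂)

      touch-first : CentreInv c z t w x → Post c c′ t → Result t w x
      touch-first (mild kx _ mw) po with post-U po
      ... | inj₁ k = inj₁ (mild (K-calm cx kx) (col k) (Mild-calm ex cw sw mw))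
      ... | inj₂ u = inj₂ (mend (K-calm cx kx) u (Mild-calm ex cw sw mw))
      touch-first (third qx _ aw _) po with post-U po
      ... | inj₁ k = inj₁ (third (Quiet-calm ex cx qx) (col k) (Act-calm cw aw) (notSame-col k))
      ... | inj₂ u = inj₂ (side (Quiet-calm ex cx qx) u (Act-calm cw aw))
      touch-first (half ku _ _) _ = ⊥-elim (K-U ku ut)
      touch-first (both _ aw ox _) po with post-U po
      ... | inj₁ k = inj₁ (half k (Inact-calm cw aw) (One-calm cx ox))
      ... | inj₂ u = inj₂ (open₁ u (Inact-calm cw aw) (One-calm cx ox))
      touch-first (lone au aw ux) (now k) = inj₂ (last (inj₁ k) (inj₂ (Inact-calm cw aw)) (U-calm cx ux))
      touch-first (lone au aw ux) (new _ o) = inj₂ (mid o (Inact-calm cw aw) (U-calm cx ux))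
      touch-first (lone au aw ux) (again na _) = ⊥-elim (na au)

    module _ (C : Centre z u t x) where
      open Kids (Centre.kids C)
      private
        cu = calm kid₁ ≢₁₂
        cx = calm kid₃ (≢-sym ≢₂₃)
        su = still kid₁ ≢₁₂

      -- The new activity below `w` is dangerous only if it brings the very colour that `u` adds to
      -- the star; `Differ` was stored for this case.
      both-new : OneActive c′ u → Tame c′ z u ⊎ Differ c′ u x → OneActive c′ x → OneActive c′ t → CentreTurn c′ z u t x
      both-new ou (inj₁ tu) ox ot = trim ox (one ou) (one ot) (notSame-tame tu)
      both-new ou (inj₂ (y , e , cy , ye , nd)) ox ot with hot z ou | hot z ot
      ... | inj₁ tu | _ = trim ox (one ou) (one ot) (notSame-tame tu)
      ... | _ | inj₁ tw = trim ox (one ou) (one ot) (notSame-sym (notSame-tame tw))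
      ... | inj₂ (d , niz , on , k , ck , kd) | inj₂ (d′ , _ , on′ , _) with d ≟ d′
      ...   | no ne = trim ox (one ou) (one ot) λ _ _ a b r s → ⊥-elim (ne (trans (sym (on a r)) (on′ b s)))
      ...   | yes refl = equal ou ot (proj₁ ox) niz on on′ λ cy′ r →
                -- A child of `x` with colour `d` would be `y`, its only coloured child; but the
                -- colour of `y` is absent below `u`, where `k` has colour `d`.
                case one-only ox cy cy′ (_ , ye) (_ , r) of λ { refl →
                  nd ck (trans kd (trans (sym r) ye)) }

      cond-calm : Blank c u → Tame c z u ⊎ Differ c u x → Tame c′ z u ⊎ Differ c′ u x
      cond-calm uu (inj₁ tu) = inj₁ (Tame-calm ex su uu tu)
      cond-calm uu (inj₂ df) = inj₂ (Differ-calm ex uu su df)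

      -- `mild`, `third` and `lone` are symmetric in the two 4-children and reduce to `touch-first`
      -- at the mirrored centre; in `half` and `both` the second child is the inactive one and is
      -- treated directly.
      touch-second : CentreInv c z u t x → Post c c′ t → Result u t x ⊎ Result t u x
      touch-second (mild kx mu mt) po = inj₂ (touch-first (mirror C) (mild kx mt mu) po)
      touch-second (third qx au at ns) po = inj₂ (touch-first (mirror C) (third qx at au (notSame-sym ns)) po)
      touch-second (lone au at ux) po = inj₂ (touch-first (mirror C) (lone at au ux) po)
      touch-second (half ku _ ox) (now k) = inj₁ (inj₂ (last (inj₁ (K-calm cu ku)) (inj₁ k) (U-calm cx (proj₁ ox))))
      touch-second (half ku _ ox) (new _ o) =
        inj₁ (inj₂ (trim (One-calm cx ox) (col (K-calm cu ku)) (one o) (notSame-col (K-calm cu ku))))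
      touch-second (half _ at _) (again na _) = ⊥-elim (na at)
      touch-second (both ou _ ox _) (now k) =
        inj₁ (inj₂ (trim (One-calm cx ox) (one (One-calm cu ou)) (col k) (notSame-sym (notSame-col k))))
      touch-second (both ou _ ox cond) (new _ o) =
        inj₁ (inj₂ (both-new (One-calm cu ou) (cond-calm (proj₁ ou) cond) (One-calm cx ox) o))
      touch-second (both _ at _ _) (again na _) = ⊥-elim (na at)

    module _ (C : Centre z u w t) where
      open Kids (Centre.kids C)
      private
        cu = calm kid₁ ≢₁₃
        cw = calm kid₂ ≢₂₃
        su = still kid₁ ≢₁₃
        sw = still kid₂ ≢₂₃

      touch-third : CentreInv c z u w t → Post c c′ t → Result u w t
      touch-third (mild kx _ _) _ = ⊥-elim (K-U kx ut)
      touch-third (third _ au aw ns) (now k) =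
        inj₂ (split k (Act-calm cu au) (Act-calm cw aw) (NotSame-calm ex cu cw su sw ns))
      touch-third (third _ au aw ns) (new _ o) =
        inj₂ (trim o (Act-calm cu au) (Act-calm cw aw) (NotSame-calm ex cu cw su sw ns))
      touch-third (third (dead a) au aw ns) (again _ b) =
        inj₁ (third (dead (Dead-ext ex b a)) (Act-calm cu au) (Act-calm cw aw) (NotSame-calm ex cu cw su sw ns))
      touch-third (third (inact a) _ _ _) (again na _) = ⊥-elim (na a)
      touch-third (half ku aw _) (now k) = inj₁ (mild k (col (K-calm cu ku)) (mild-inact (Inact-calm cw aw)))
      touch-third (half ku aw _) (new _ o) = inj₁ (half (K-calm cu ku) (Inact-calm cw aw) o)
      touch-third (half ku aw _) (again _ b) = inj₂ (last (inj₁ (K-calm cu ku)) (inj₂ (Inact-calm cw aw)) b)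
      touch-third (both ou aw _ _) (now k) =
        inj₂ (split k (one (One-calm cu ou)) (act-inact (Inact-calm cw aw)) (notSame-inact (Inact-calm cw aw)))
      touch-third (both ou aw _ _) (new _ o) = inj₂ (open₁ (proj₁ (One-calm cu ou)) (Inact-calm cw aw) o)
      touch-third (both ou aw _ _) (again _ b) = inj₂ (mid (One-calm cu ou) (Inact-calm cw aw) b)
      touch-third (lone au aw _) po with post-U po
      ... | inj₁ k = inj₁ (mild k (mild-inact (Inact-calm cu au)) (mild-inact (Inact-calm cw aw)))
      ... | inj₂ b = inj₁ (lone (Inact-calm cu au) (Inact-calm cw aw) b)

    centre-touch : Centre z u w x → Safe c z → CentreInv c z u w x → Post c c′ t → Turn c′ z
    centre-touch C sz b po with Kids.only (Centre.kids C) ct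
    ... | inj₁ refl = centre C (Safe-ext ex sz) (touch-first C b po)
    ... | inj₂ (inj₂ refl) = centre C (Safe-ext ex sz) (touch-third C b po)
    ... | inj₂ (inj₁ refl) with touch-second C b po
    ...   | inj₁ r = centre C (Safe-ext ex sz) r
    ...   | inj₂ r = centre (mirror C) (Safe-ext ex sz) r

  -- Two children of a blank z are busy, so z has to be coloured.
  data Broken (c : Col) (z : Edge) : Set where
    two : Child i z → Child j z → i ≢ j → Tight c i → Tight c j →
          (∀ {k} → Child k z → k ≢ i → k ≢ j → Inactive c k) → Broken c z
    double : Child i z → ¬ Four i → Blank c i → (∀ {k} → Child k z → k ≢ i → Inactive c k) → Broken c z

  -- A child of `z` may be coloured instead only if no 4-vertex lies at the parent of `z`: otherwise
  -- the star above relies on `z` becoming coloured.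
  Repair : Col → Edge → Set
  Repair c z = ∃ λ e → ∃ λ α → Legal G c e α ×
    (e ≡ z ⊎ (Child e z × ∀ {p} → Child z p → ¬ Four p)) × (∀ {c′} → Step c c′ e α → Inv c′ z)

  module _ (op : Open c) (uz : Blank c z) where

    colour-top : (∀ {α c′} → Step c c′ z α → Inv c′ z) → Repair c z
    colour-top inv with op uz
    ... | α , l = z , α , l , inj₁ refl , inv

    plain-repair : Plain z → Four z → Broken c z → Repair c z
    plain-repair pl fz (double ci nf ui oth) with four-kids fz ci
    ... | _ , _ , ks = colour-top λ st → plain pl (_ , after st)
          (s₂ ks nf (U-calm (claim-calm st kid₁) ui)
            (inact (Inact-calm (claim-calm st kid₂) (oth kid₂ (≢-sym ≢₁₂))))
            (inact (Inact-calm (claim-calm st kid₃) (oth kid₃ (≢-sym ≢₁₃)))))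
      where open Kids ks
    plain-repair pl fz (two {i} {j} ci cj ne ai aj oth) with four-kids fz ci
    ... | _ , _ , ks with Kids.only ks cj
    ...   | inj₁ refl = ⊥-elim (ne refl)
    ...   | inj₂ (inj₁ refl) = colour-top λ st → plain pl (_ , after st)
            (s₁ (swap₂₃ ks) (act-soft (Act-calm (claim-calm st kid₁) ai))
              (inact (Inact-calm (claim-calm st kid₃) (oth kid₃ (≢-sym ≢₁₃) (≢-sym ≢₂₃))))
              (act-soft (Act-calm (claim-calm st kid₂) aj)))
      where open Kids ks
    ...   | inj₂ (inj₂ refl) = colour-top λ st → plain pl (_ , after st)
            (s₁ ks (act-soft (Act-calm (claim-calm st kid₁) ai))
              (inact (Inact-calm (claim-calm st kid₂) (oth kid₂ (≢-sym ≢₁₂) ≢₂₃)))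
              (act-soft (Act-calm (claim-calm st kid₃) aj)))
      where open Kids ks

    up-has? : ∀ d → (∃ λ t → Up z t × c t ≡ just d) ⊎ (∀ {t} → Up z t → c t ≢ just d)
    up-has? d with any? (λ t → ((¬? (t ≟ z) ×-dec ≡-dec _≟_ (par t) (par z)) ⊎-dec child? z t) ×-dec has? c t d)
    ... | yes p = inj₁ p
    ... | no ¬p = inj₂ λ {t} u r → ¬p (t , u , r)

    colour-with : ¬ InZ c z d → (∀ {t} → Up z t → c t ≢ just d) →
      (∀ {c′} → Step c c′ z d → Inv c′ z) → Repair c z
    colour-with {d} niz no-up inv = z , d , legal-at uz (λ
      { (inj₁ u) r → no-up u r ; (inj₂ ch) r → niz (_ , inj₂ ch , r) }) , inj₁ refl , inv

    only-tame : Child u z → Only c u d → Blank c u → Step c c′ z d → Tame c′ z u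
    only-tame cu on uu st ch r = z , inj₁ refl ,
      trans (after st) (cong just (sym (on ch (trans (sym (claim-still st cu uu ch)) r))))

    -- When d is already seen from above, a child of z takes the colour d instead of z.
    module CentreRepair (C : Centre z u w x) where
      open Kids (Centre.kids C)
      open Centre C using (narrow₃; top)

      topped : Step c c′ z α → CentreInv c′ z u w x → Inv c′ z
      topped st = centre C (inj₁ (_ , after st))

      instead : Up z t → c t ≡ just d → Child h z → Inactive c h → ¬ InZ c z d →
        (∀ {c′} → Step c c′ h d → CentreInv c′ z u w x) → Repair c z
      instead {h = h} ut td ch ah niz inv = h , _ ,
        legal-kid ch (ah self) niz (λ cy r → just≢nothing r (ah (up self cy))) , inj₂ (ch , top) ,
        λ st → centre C (inj₂ (h , _ , _ , ch , ut , after st , step-ext st td)) (inv st)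

      only-tame′ : Step c c′ h d → Child h z → Child v z → v ≢ h → Only c v d → Blank c v → Tame c′ z v
      only-tame′ {h = h} st ch cu ne on uu cy r = h , inj₂ ch ,
        trans (after st) (cong just (sym (on cy (trans (sym (kid-still st ch cu ne uu cy)) r))))

      -- Any colour on `z` gives `third` unless `u` and `w` share a new colour `d`. Then `d` itself
      -- is put on `z`, or on `x` if it is seen from above; either choice makes both of them tame.
      four-four : Tight c u → Tight c w → Inactive c x → Repair c z
      four-four (col ku) aw ax = colour-top λ st → topped st (third (inact (Inact-calm (claim-calm st kid₃) ax))
        (col (K-calm (claim-calm st kid₁) ku)) (Act-calm (claim-calm st kid₂) aw)
        (notSame-col (K-calm (claim-calm st kid₁) ku)))
      four-four (one ou) (col kw) ax = colour-top λ st → topped st (third (inact (Inact-calm (claim-calm st kid₃) ax))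
        (one (One-calm (claim-calm st kid₁) ou)) (col (K-calm (claim-calm st kid₂) kw))
        (notSame-sym (notSame-col (K-calm (claim-calm st kid₂) kw))))
      four-four (one ou) (one ow) ax = go (hot z ou) (hot z ow)
        where
        any-top : NotSame c z u w → Repair c z
        any-top ns = colour-top λ st → topped st (third (inact (Inact-calm (claim-calm st kid₃) ax))
          (one (One-calm (claim-calm st kid₁) ou)) (one (One-calm (claim-calm st kid₂) ow))
          (NotSame-calm (step-ext st) (claim-calm st kid₁) (claim-calm st kid₂) (claim-still st kid₁) (claim-still st kid₂) ns))
        go : Tame c z u ⊎ ∃ (Hot c z u) → Tame c z w ⊎ ∃ (Hot c z w) → Repair c z
        go (inj₁ tu) _ = any-top (notSame-tame tu)
        go (inj₂ _) (inj₁ tw) = any-top (notSame-sym (notSame-tame tw))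
        go (inj₂ (d , niz , on , _)) (inj₂ (d′ , _ , on′ , _)) with d ≟ d′
        ... | no ne = any-top λ _ _ a b r s → ⊥-elim (ne (trans (sym (on a r)) (on′ b s)))
        ... | yes refl with up-has? d
        ...   | inj₂ no-up = colour-with niz no-up λ st → topped st (third (inact (Inact-calm (claim-calm st kid₃) ax))
                (one (One-calm (claim-calm st kid₁) ou)) (one (One-calm (claim-calm st kid₂) ow))
                (notSame-tame (only-tame kid₁ on (proj₁ ou) st)))
        ...   | inj₁ (t , ut , td) = instead ut td kid₃ ax niz λ st → mild (_ , after st)
                (tame (One-calm (kid-calm st kid₃ kid₁ ≢₁₃) ou) (only-tame′ st kid₃ kid₁ ≢₁₃ on (proj₁ ou)))
                (tame (One-calm (kid-calm st kid₃ kid₂ ≢₂₃) ow) (only-tame′ st kid₃ kid₂ ≢₂₃ on′ (proj₁ ow)))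

      -- With `u` coloured any colour of `z` will do. Otherwise `Tame` is wanted for `u`, or
      -- `Differ` as a substitute; the obstacle is a new colour `d` below `u` that cannot be put on
      -- `z`.
      four-narrow : Tight c u → Tight c x → Inactive c w → Repair c z
      four-narrow (col ku) (col kx) aw = colour-top λ st → topped st (mild (K-calm (claim-calm st kid₃) kx)
        (col (K-calm (claim-calm st kid₁) ku)) (mild-inact (Inact-calm (claim-calm st kid₂) aw)))
      four-narrow (col ku) (one ox) aw = colour-top λ st → topped st (half (K-calm (claim-calm st kid₁) ku)
        (Inact-calm (claim-calm st kid₂) aw) (One-calm (claim-calm st kid₃) ox))
      four-narrow (one ou) ax aw = go (hot z ou)
        where
        tame-top : Tight c x → Step c c′ z α → Tame c′ z u → Inv c′ z
        tame-top (col kx) st t = topped st (mild (K-calm (claim-calm st kid₃) kx)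
          (tame (One-calm (claim-calm st kid₁) ou) t) (mild-inact (Inact-calm (claim-calm st kid₂) aw)))
        tame-top (one ox) st t = topped st (both (One-calm (claim-calm st kid₁) ou)
          (Inact-calm (claim-calm st kid₂) aw) (One-calm (claim-calm st kid₃) ox) (inj₁ t))
        go : Tame c z u ⊎ ∃ (Hot c z u) → Repair c z
        go (inj₁ tu) = colour-top λ st → tame-top ax st
          (Tame-calm (step-ext st) (claim-still st kid₁) (proj₁ ou) tu)
        go (inj₂ (d , niz , on , k , ck , kd)) with up-has? d
        ... | inj₂ no-up = colour-with niz no-up λ st → tame-top ax st (only-tame kid₁ on (proj₁ ou) st)
        ... | inj₁ (t , ut , td) = seen ax
          where
          seen : Tight c x → Repair c z
          seen (col kx) = instead ut td kid₂ aw niz λ st → mild (K-calm (kid-calm st kid₂ kid₃ (≢-sym ≢₂₃)) kx)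
            (tame (One-calm (kid-calm st kid₂ kid₁ ≢₁₂) ou) (only-tame′ st kid₂ kid₁ ≢₁₂ on (proj₁ ou)))
            (col (_ , after st))
          seen (one ox) with any? (λ y → child? y x ×-dec ¬? (u? c y))
          -- No child of `x` is coloured, so `x` can take `d`; with `t` above this also makes `z`
          -- safe.
          ... | no ¬busy = x , d , legal-kid kid₃ (proj₁ ox) niz (λ ch r → ¬busy (_ , ch , just≢nothing r)) ,
                inj₂ (kid₃ , top) , λ st → centre C (inj₂ (x , t , d , kid₃ , ut , after st , step-ext st td))
                (mild (_ , after st)
                  (tame (One-calm (kid-calm st kid₃ kid₁ ≢₁₃) ou) (only-tame′ st kid₃ kid₁ ≢₁₃ on (proj₁ ou)))
                  (mild-inact (Inact-calm (kid-calm st kid₃ kid₂ ≢₂₃) aw)))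
          ... | yes (y , cy , ny) with K⊎U c y
          ...   | inj₂ uy = ⊥-elim (ny uy)
          ...   | inj₁ (e , ye) with e ≟ d
          -- With `d` on `w` the star repeats the colour of `y`, and `x` becomes dead.
          ...     | yes refl = instead ut td kid₂ aw niz λ st → third
                    (dead (narrow-dead narrow₃ (U-calm (kid-calm st kid₂ kid₃ (≢-sym ≢₂₃)) (proj₁ ox)) cy
                      (step-ext st ye) (w , inj₂ kid₂ , after st)))
                    (one (One-calm (kid-calm st kid₂ kid₁ ≢₁₂) ou)) (col (_ , after st))
                    (notSame-sym (notSame-col (_ , after st)))
          -- All colours below `u` equal `d`, so `y` with its other colour is a witness for `Differ`
          -- and `z` may take any colour.
          ...     | no ne = colour-top λ st → topped st (both (One-calm (claim-calm st kid₁) ou)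
                    (Inact-calm (claim-calm st kid₂) aw) (One-calm (claim-calm st kid₃) ox)
                    (inj₂ (Differ-calm (step-ext st) (proj₁ ou) (claim-still st kid₁)
                      (y , e , cy , ye , λ ch r → ne (on ch r)))))

      single : ¬ Four i → Blank c i → Child i z → (∀ {k} → Child k z → k ≢ i → Inactive c k) → Repair c z
      single nf ui ci oth with only ci
      ... | inj₁ refl = ⊥-elim (nf (Centre.four₁ C))
      ... | inj₂ (inj₁ refl) = ⊥-elim (nf (Centre.four₂ C))
      ... | inj₂ (inj₂ refl) = colour-top λ st → topped st (lone (Inact-calm (claim-calm st kid₁) (oth kid₁ ≢₁₃))
            (Inact-calm (claim-calm st kid₂) (oth kid₂ ≢₂₃)) (U-calm (claim-calm st kid₃) ui))

    centre-repair : Centre z u w x → Broken c z → Repair c z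
    centre-repair C (double ci nf ui oth) = CentreRepair.single C nf ui ci oth
    centre-repair C (two ci cj ne ai aj oth) with Kids.only (Centre.kids C) ci | Kids.only (Centre.kids C) cj
    ... | inj₁ refl | inj₁ refl = ⊥-elim (ne refl)
    ... | inj₂ (inj₁ refl) | inj₂ (inj₁ refl) = ⊥-elim (ne refl)
    ... | inj₂ (inj₂ refl) | inj₂ (inj₂ refl) = ⊥-elim (ne refl)
    ... | inj₁ refl | inj₂ (inj₁ refl) = CentreRepair.four-four C ai aj (oth kid₃ (≢-sym ≢₁₃) (≢-sym ≢₂₃))
      where open Kids (Centre.kids C)
    ... | inj₂ (inj₁ refl) | inj₁ refl = CentreRepair.four-four C aj ai (oth kid₃ (≢-sym ≢₂₃) (≢-sym ≢₁₃))
      where open Kids (Centre.kids C)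
    ... | inj₁ refl | inj₂ (inj₂ refl) = CentreRepair.four-narrow C ai aj (oth kid₂ (≢-sym ≢₁₂) ≢₂₃)
      where open Kids (Centre.kids C)
    ... | inj₂ (inj₂ refl) | inj₁ refl = CentreRepair.four-narrow C aj ai (oth kid₂ ≢₂₃ (≢-sym ≢₁₂))
      where open Kids (Centre.kids C)
    ... | inj₂ (inj₁ refl) | inj₂ (inj₂ refl) = CentreRepair.four-narrow (mirror C) ai aj (oth kid₁ ≢₁₂ ≢₁₃)
      where open Kids (Centre.kids C)
    ... | inj₂ (inj₂ refl) | inj₂ (inj₁ refl) = CentreRepair.four-narrow (mirror C) aj ai (oth kid₁ ≢₁₃ ≢₁₂)
      where open Kids (Centre.kids C)

    repair : Four z → Broken c z → Repair c z
    repair fz br with kind fz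
    ... | inj₁ pl = plain-repair pl fz br
    ... | inj₂ (_ , _ , _ , C) = centre-repair C br

-- The strategy: from Bob's move to Alice's reply in the whole tree

module Strategy (G : Graph) (R : Rooted G) where
  open Graph G using (m)
  open Play G R
  open Steps G R
  open Replies G R
  open Damage G R

  private variable
    c c′ c″ : Col
    e f g h i j k p s t u v w x y z : Edge
    α β d : Fin 5

  calmAt-trans : CalmAt c c′ s → CalmAt c′ c″ s → CalmAt c c″ s
  calmAt-trans a b = record
    { same = trans (CalmAt.same b) (CalmAt.same a)
    ; below = λ us ch q → CalmAt.below b (U-calm a us) ch (CalmAt.below a us ch q) }

  still-trans : CalmAt c c′ s → Still c c′ s → Still c′ c″ s → Still c c″ s
  still-trans a b d us ch = trans (d (U-calm a us) ch) (b us ch)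

  -- Bob colours below the 4-vertex v, Alice replies at v: the star above v survives.
  module Couple (fv : Four v) (cv : Child v p) (uv : Blank c v) (nv : ¬ Inactive c v)
    (st : Step c c′ e α) (q : e ≼ v) (ne : e ≢ v) (st′ : Step c′ c″ v β) where

    ex : Ext c c″
    ex a = step-ext st′ (step-ext st a)

    calm : Child s p → s ≢ v → CalmAt c c″ s
    calm cs n = calmAt-trans (calmAt-off st λ q′ → n (branch cs cv q′ q)) (kid-calm st′ cv cs n)

    still : Child s p → s ≢ v → Still c c″ s
    still cs n = still-trans (calmAt-off st λ q′ → n (branch cs cv q′ q)) (still-but st q cv cs n) (kid-still st′ cv cs n)

    kv : Coloured c″ v
    kv = _ , after st′

    not-quiet : ¬ Quiet c p v
    not-quiet (dead (nf , _)) = nf fv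
    not-quiet (inact a) = nv a

    couple-plain : PlainInv c p → PlainInv c″ p
    couple-plain (done a) = ⊥-elim (K-U (a cv) uv)
    couple-plain (s₁ ks a b d) with Kids.only ks cv
    ... | inj₁ refl = s₁ ks (col kv) (Quiet-calm ex (calm kid₂ (≢-sym ≢₁₂)) b) (Soft-calm ex (calm kid₃ (≢-sym ≢₁₃)) d)
      where open Kids ks
    ... | inj₂ (inj₁ refl) = ⊥-elim (not-quiet b)
    ... | inj₂ (inj₂ refl) = s₁ ks (Soft-calm ex (calm kid₁ ≢₁₃) a) (Quiet-calm ex (calm kid₂ ≢₂₃) b) (col kv)
      where open Kids ks
    couple-plain (s₂ ks nf a b d) with Kids.only ks cv
    ... | inj₁ refl = ⊥-elim (nf fv)
    ... | inj₂ (inj₁ refl) = ⊥-elim (not-quiet b)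
    ... | inj₂ (inj₂ refl) = ⊥-elim (not-quiet d)

    couple-first : Centre p v w x → CentreInv c p v w x → CentreInv c″ p v w x
    couple-first {w} {x} C = go
      where
      open Kids (Centre.kids C)
      cw = calm kid₂ (≢-sym ≢₁₂)
      cx = calm kid₃ (≢-sym ≢₁₃)
      go : CentreInv c p v w x → CentreInv c″ p v w x
      go (mild kx _ mw) = mild (K-calm cx kx) (col kv) (Mild-calm ex cw (still kid₂ (≢-sym ≢₁₂)) mw)
      go (third qx _ aw _) = third (Quiet-calm ex cx qx) (col kv) (Act-calm cw aw) (notSame-col kv)
      go (half _ aw ox) = half kv (Inact-calm cw aw) (One-calm cx ox)
      go (both _ aw ox _) = half kv (Inact-calm cw aw) (One-calm cx ox)
      go (lone av _ _) = ⊥-elim (nv av)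

    couple-centre : Centre p u w x → Safe c p → CentreInv c p u w x → Inv c″ p
    couple-centre C sp b with Kids.only (Centre.kids C) cv
    ... | inj₁ refl = centre C (Safe-ext ex sp) (couple-first C b)
    ... | inj₂ (inj₂ refl) = ⊥-elim (Centre.narrow₃ C fv)
    ... | inj₂ (inj₁ refl) = go b
      where
      again′ : CentreInv c p v _ _ → Inv c″ p
      again′ b = centre (mirror C) (Safe-ext ex sp) (couple-first (mirror C) b)
      go : CentreInv c p _ v _ → Inv c″ p
      go (mild kx mu mw) = again′ (mild kx mw mu)
      go (third qx au aw ns) = again′ (third qx aw au (notSame-sym ns))
      go (half _ av _) = ⊥-elim (nv av)
      go (both _ av _ _) = ⊥-elim (nv av)
      go (lone _ av _) = ⊥-elim (nv av)

    couple : Inv c p → Inv c″ p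
    couple (wait (waiting {h = h} up′ ch oth a)) with v ≟ h
    ... | no n = ⊥-elim (nv (oth cv n))
    ... | yes refl = wait (waiting (U-off st′ (λ { refl → acyclic cv self }) (U-off st (λ { refl → acyclic cv q }) up′)) cv
            (λ ck n → Inact-calm (calm ck n) (oth ck n)) (col kv))
    couple (plain pl (γ , kp) b) = plain pl (γ , ex kp) (couple-plain b)
    couple (centre C sp b) = couple-centre C sp b

  plain-centre : Plain z → ¬ Centre z u w x
  plain-centre pl C with pl (Kids.kid₁ (Centre.kids C)) (Kids.kid₂ (Centre.kids C)) (Kids.≢₁₂ (Centre.kids C))
  ... | inj₁ nf = nf (Centre.four₁ C)
  ... | inj₂ nf = nf (Centre.four₂ C)

  -- Either way a move below `z` is of no concern to a star at the parent of `z`.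
  Anchored : Col → Edge → Set
  Anchored c z = Coloured c z ⊎ (∀ {p} → Child z p → ¬ Four p)

  turn-anchored : Turn c z → Anchored c z
  turn-anchored (plain _ k _) = inj₁ k
  turn-anchored (centre C _ _) = inj₂ (Centre.top C)

  -- The position after a move of Bob: at most one star, or one star and its parent, needs care.
  data Outcome (c : Col) : Set where
    fine : AllInv c → Outcome c
    hurt : Four z → Turn c z → ¬ Inactive c z → (∀ {z′} → Four z′ → z′ ≢ z → Inv c z′) → Outcome c
    broken : Four z → Blank c z → Broken c z → ¬ Inactive c z →
      (∀ {z′} → Four z′ → z′ ≢ z → ¬ Child z z′ → Inv c z′) →
      (∀ {p} → Four p → Child z p → ∀ {c′ β} → Step c c′ z β → Inv c′ p) → Outcome c

  act-step : Step c c′ e α → ¬ Inactive c y → ¬ Inactive c′ y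
  act-step st na a = na λ q → U-back st (a q)

  waiting-U : Waiting c z → Blank c z
  waiting-U (waiting a _ _ _) = a

  module Bob (inv : AllInv c) (st : Step c c′ e α) where

    waiting-parent : Waiting c z → Child h z → ¬ Inactive c h → Blank c′ z → Tight c′ h →
      (∀ {k} → Child k z → k ≢ h → CalmAt c c′ k) → Waiting c′ z
    waiting-parent {h = h} (waiting {h = h₀} uz ch₀ oth _) ch nh uz′ ah ca with h ≟ h₀
    ... | yes refl = waiting uz′ ch (λ ck ne → Inact-calm (ca ck ne) (oth ck ne)) ah
    ... | no ne = ⊥-elim (nh (oth ch ne))

    -- No edge becomes active by this move. A star can suffer only if `e` is one of its children, or
    -- if it is a centre that records the colour of `e`.
    module Wild (na : ¬ Inactive c e) where

      others : Four z → ¬ Child e z →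
        (∀ {h} → Child e h → Child h z → Coloured c h ⊎ (∀ {u w x} → Centre z u w x → ¬ Four h)) → Inv c′ z
      others {z} fz nc hot with e ≼? z
      ... | no ne = inv-away st ne (inv fz)
      ... | yes self = claim st fz (inv fz)
      ... | yes (up self ch) = ⊥-elim (nc ch)
      ... | yes (up (up {h = y} q cy) ch) with e ≟ y
      ...   | no ne = inv-deep st q cy ch (λ a → na (inact-≼ a q)) (λ eq → ⊥-elim (ne eq)) (inv fz)
      ...   | yes refl with hot cy ch
      ...     | inj₁ kh = inv-coloured st (up q cy) ch kh (inv fz)
      ...     | inj₂ n4 = inv-deep st q cy ch na (λ _ → n4) (inv fz)

      module WaitingStar (ce : Child e z) (fz : Four z) (wz : Waiting c z) where

        uz : Blank c z
        uz = waiting-U wz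

        kept : Inv c′ z
        kept = wait (waiting-parent wz ce na (U-off st (λ { refl → acyclic ce self }) uz) (col (_ , after st))
          λ ck ne → calmAt-off st λ q → ne (sym (same-parent ce ck q)))

        rest : Four v → ¬ Child z v → Inv c′ v
        rest {v} fv nc with v ≟ z
        ... | yes refl = kept
        ... | no ne = others fv (λ ce′ → ne (just-injective (trans (sym ce′) ce)))
              λ ce′ ch → ⊥-elim (nc (subst (λ h → Child h v) (just-injective (trans (sym ce′) ce)) ch))

        z-act : ¬ Inactive c z
        z-act a = na (inact-≼ a (up self ce))

        above : Four p → Child z p → Inv c p → Outcome c′
        above {p} fp cz ip = go ip
          where
          unique : Child z v → v ≡ p
          unique cz′ = just-injective (trans (sym cz′) cz)
          all-fine : Inv c′ p → Outcome c′
          all-fine ip′ = fine λ {v} fv → case child? z v of λ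
            { (no n) → rest fv n
            ; (yes y) → subst (Inv c′) (sym (unique y)) ip′ }
          calm : CalmAt c c′ z
          calm = calmAt-deep st self ce na
          go : Inv c p → Outcome c′
          go (wait wp) = all-fine (wait (wait-calm (off st λ { refl → acyclic cz (up self ce) })
            (calm-but st (up self ce) cz calm) wp))
          go ip@(plain pl _ _) = all-fine (inv-deep st self ce cz na (λ _ C → ⊥-elim (plain-centre pl C)) ip)
          -- A centre records the colours below its 4-child `z`, and `e` has added one; hence this
          -- star, and not the waiting one, needs the reply.
          go (centre C sp b) = hurt fp
            (Touched.centre-touch st (up self ce) cz uz C sp b (again z-act (U-off st (λ { refl → acyclic ce self }) uz)))
            (act-step st λ a → z-act (inact-≼ a (up self cz)))
            λ fv ne → rest fv λ cz′ → ne (unique cz′)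

        outcome : Outcome c′
        outcome = go (par z) refl
          where
          go : ∀ o → par z ≡ o → Outcome c′
          go nothing eq = fine λ fv → rest fv λ cz → just≢nothing cz eq
          go (just p) eq with four? p
          ... | yes fp = above fp eq (inv fp)
          ... | no nf = fine λ fv → rest fv λ cz → nf (subst Four (just-injective (trans (sym cz) eq)) fv)

      at-star : Child e z → Four z → Outcome c′
      at-star {z} ce fz = go (inv fz)
        where
        nz : ¬ Inactive c′ z
        nz = K-act (_ , after st) (up self ce)
        rest : Anchored c z → Four v → v ≢ z → Inv c′ v
        rest {v} an fv ne = others fv (λ ce′ → ne (just-injective (trans (sym ce′) ce))) λ {h} ce′ ch →
          let eq = just-injective (trans (sym ce′) ce) in
          case an of λ
            { (inj₁ kz) → inj₁ (subst (Coloured c) (sym eq) kz)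
            ; (inj₂ top) → ⊥-elim (top (subst (λ h → Child h v) eq ch) fv) }
        go : Inv c z → Outcome c′
        go (wait wz) = WaitingStar.outcome ce fz wz
        go (plain pl kz b) = hurt fz (plain pl (proj₁ kz , step-ext st (proj₂ kz))
          (Touched.plain-touch st self ce (before st) b (now (_ , after st)) tt)) nz (rest (inj₁ kz))
        go (centre C sz b) = hurt fz (Touched.centre-touch st self ce (before st) C sz b (now (_ , after st)))
          nz (rest (inj₂ (Centre.top C)))

      outcome : Outcome c′
      outcome = go (par e) refl
        where
        go : ∀ o → par e ≡ o → Outcome c′
        go nothing eq = fine λ fv → others fv (λ ce → just≢nothing ce eq) λ ce _ → ⊥-elim (just≢nothing ce eq)
        go (just z) eq with four? z
        ... | yes fz = at-star eq fz
        ... | no nf = fine λ fv → others fv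
              (λ ce → nf (subst Four (just-injective (trans (sym ce) eq)) fv))
              λ ce ch → inj₂ λ _ fh → nf (subst Four (just-injective (trans (sym ce) eq)) fh)

    -- f is the lowest active edge on the way up from e.
    module Meet (q : e ≼ h) (ah : Inactive c h) (ch : Child h f) (nf : ¬ Inactive c f) where

      below : e ≼ f
      below = up q ch

      e≢f : e ≢ f
      e≢f refl = acyclic ch q

      others : Four z → z ≢ f → ¬ Child f z → Inv c′ z
      others {z} fz z≢f nc with e ≼? z
      ... | no ne = inv-away st ne (inv fz)
      ... | yes r with ≼-total r q
      ...   | inj₁ z≼h = fresh st fz (inact-≼ ah z≼h) r
      ...   | inj₂ h≼z with climb h≼z
      ...     | inj₁ refl = fresh st fz ah r
      ...     | inj₂ (f′ , ch′ , f≼z) with just-injective (trans (sym ch′) ch)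
      ...       | refl = go f≼z
        where
        go : f ≼ z → Inv c′ z
        go self = ⊥-elim (z≢f refl)
        go (up self cf) = ⊥-elim (nc cf)
        go (up (up f≼y cy) cz) = inv-deep st (≼-trans below f≼y) cy cz (λ a → nf (inact-≼ a f≼y))
          (λ { refl → ⊥-elim (acyclic ch (≼-trans f≼y q)) }) (inv fz)

      touched : Tight c′ h
      touched = touch st ah q

      post : Tight c′ h → Post c c′ h
      post (col k) = now k
      post (one o) = new ah o

      narrow-post : (a : Tight c′ h) → Touched.NarrowAgain st q ch (ah self) (post a)
      narrow-post (col _) = tt
      narrow-post (one _) = tt

      nf′ : ¬ Inactive c′ f
      nf′ = act-step st nf

      coupled : Four v → Child v p → Four p → Blank c v → ¬ Inactive c v → e ≼ v → e ≢ v → Step c′ c″ v β → Inv c″ p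
      coupled fv cv fp uv nv r ne st′ = Couple.couple fv cv uv nv st r ne st′ (inv fp)

      at-star : Four f → Outcome c′
      at-star ff = go (inv ff)
        where
        rest : Anchored c f → Four z → z ≢ f → Inv c′ z
        rest {z} an fz ne with child? f z
        ... | no nc = others fz ne nc
        ... | yes cf with an
        ...   | inj₁ kf = inv-coloured st below cf kf (inv fz)
        ...   | inj₂ top = ⊥-elim (top cf fz)
        go : Inv c f → Outcome c′
        go (plain pl kf b) = hurt ff (plain pl (proj₁ kf , step-ext st (proj₂ kf))
          (Touched.plain-touch st q ch (ah self) b (post touched) (narrow-post touched))) nf′ (rest (inj₁ kf))
        go (centre C sf b) = hurt ff (Touched.centre-touch st q ch (ah self) C sf b (post touched))
          nf′ (rest (inj₂ (Centre.top C)))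
        go (wait (waiting {h = h₀} uf ch₀ oth a)) with h ≟ h₀
        -- If `h` were the child on which the star waits, all children of the blank `f` would be
        -- inactive, although `f` is active.
        ... | yes refl = ⊥-elim (nf (inact-intro uf λ {y} cy → case y ≟ h of λ
                { (yes refl) → ah ; (no ne) → oth cy ne }))
        ... | no ne = broken ff (U-off st (≢-sym e≢f) uf)
                (two ch₀ ch (≢-sym ne) (Act-calm (calm ch₀ (≢-sym ne)) a) touched
                  λ ck ne₀ ne₁ → Inact-calm (calm ck ne₁) (oth ck ne₀))
                nf′ others λ fp cf → coupled ff cf fp uf nf below e≢f
          where
          calm : Child k f → k ≢ h → CalmAt c c′ k
          calm ck ne = calmAt-off st λ r → ne (branch ck ch r q)

      -- A further child of `f` becomes active. No star is kept at `f`, but the one at `z` may have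
      -- counted `f` with a single active child; a waiting `z` becomes `double`.
      at-outer : ¬ Four f → Child f z → Four z → Blank c f → Outcome c′
      at-outer {z} n4 cf fz uf = go (inv fz)
        where
        unique : Child f v → v ≡ z
        unique cf′ = just-injective (trans (sym cf′) cf)
        rest : Four v → v ≢ z → Inv c′ v
        rest fv ne = others fv (λ { refl → n4 fv }) λ cf′ → ne (unique cf′)
        nz : ¬ Inactive c z
        nz a = nf (inact-≼ a (up self cf))
        uf′ : Blank c′ f
        uf′ = U-off st (≢-sym e≢f) uf
        e≢z : e ≢ z
        e≢z refl = acyclic cf below
        go : Inv c z → Outcome c′
        go (plain pl kz b) = hurt fz (plain pl (proj₁ kz , step-ext st (proj₂ kz))
          (Touched.plain-touch st below cf uf b (again nf uf′) n4)) (act-step st nz) rest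
        go (centre C sz b) = hurt fz (Touched.centre-touch st below cf uf C sz b (again nf uf′))
          (act-step st nz) rest
        go (wait (waiting {h = h₀} uz ch₀ oth a)) with f ≟ h₀
        ... | no ne = ⊥-elim (nf (oth cf ne))
        ... | yes refl = broken fz (U-off st (≢-sym e≢z) uz)
                (double cf n4 uf′ λ ck ne → Inact-calm (calmAt-off st λ r → ne (branch ck cf r below)) (oth ck ne))
                (act-step st nz) (λ fv ne _ → rest fv ne)
                λ fp cz → coupled fz cz fp uz nz (up below cf) e≢z

      outcome : Outcome c′
      outcome with four? f
      ... | yes ff = at-star ff
      ... | no n4 = go (par f) refl
        where
        go : ∀ o → par f ≡ o → Outcome c′
        go nothing eq = fine λ fz → others fz (λ { refl → n4 fz }) λ cf → just≢nothing cf eq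
        go (just z) eq with four? z | K⊎U c f
        ... | no nz | _ = fine λ fv → others fv (λ { refl → n4 fv })
              λ cf → nz (subst Four (just-injective (trans (sym cf) eq)) fv)
        ... | yes fz | inj₂ uf = at-outer n4 eq fz uf
        ... | yes fz | inj₁ kf = fine λ {v} fv → case child? f v of λ
              { (no nc) → others fv (λ { refl → n4 fv }) nc
              ; (yes cf) → inv-coloured st below cf kf (inv fv) }

    outcome : Outcome c′
    outcome with join c e
    ... | wild na = Wild.outcome na
    ... | meet q ah ch nf = Meet.outcome q ah ch nf
    ... | none all-inact = fine λ {z} fz → case e ≼? z of λ
          { (no ne) → inv-away st ne (inv fz) ; (yes r) → fresh st fz (all-inact r) r }

  NextMove : Col → Set
  NextMove c = ∃ λ e → ∃ λ α → Legal G c e α × (∀ {c′} → Step c c′ e α → AllInv c′)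

  spot-below : Spot c z e → e ≼ z
  spot-below (kid ce) = up self ce
  spot-below (outer cy cx _ _) = up (up self cy) cx

  spot-strict : Spot c z e → ¬ z ≼ e
  spot-strict (kid ce) q = acyclic ce q
  spot-strict (outer cy cx _ _) q = acyclic cx (≼-trans q (up self cy))

  -- A star at the parent of `z` is shielded by `Anchored`. Stars further up see only activity, and
  -- `z` was active already.
  spot-others : Four z → ¬ Inactive c z → Anchored c z → Spot c z e → Step c c′ e α →
    Four v → v ≢ z → Inv c v → Inv c′ v
  spot-others {z} {c} {e} {c′} {α} {v} fz nz an sp st fv ne iv with e ≼? v
  ... | no n = inv-away st n iv
  ... | yes r with v ≟ e
  ...   | yes refl = claim st fv iv
  ...   | no v≢e = go an (over sp)
    where
    over : Spot c z e → z ≼ v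
    over (kid ce) with climb r
    ... | inj₁ refl = ⊥-elim (v≢e refl)
    ... | inj₂ (p , ce′ , s) with just-injective (trans (sym ce′) ce)
    ...   | refl = s
    over (outer cy cx n4 _) with climb r
    ... | inj₁ refl = ⊥-elim (v≢e refl)
    ... | inj₂ (p , cy′ , s) with just-injective (trans (sym cy′) cy)
    ...   | refl with climb s
    ...     | inj₁ refl = ⊥-elim (n4 fv)
    ...     | inj₂ (p′ , cx′ , s′) with just-injective (trans (sym cx′) cx)
    ...       | refl = s′
    go : Anchored c z → z ≼ v → Inv c′ v
    go _ self = ⊥-elim (ne refl)
    go (inj₁ kz) (up self cz) = inv-coloured st (spot-below sp) cz kz iv
    go (inj₂ top) (up self cz) = ⊥-elim (top cz fv)
    go _ (up (up s cy) cv) = inv-deep st (≼-trans (spot-below sp) s) cy cv (λ a → nz (inact-≼ a s))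
      (λ { refl → ⊥-elim (spot-strict sp s) }) iv

  reply-move : Four z → ¬ Inactive c z → Anchored c z → (∀ {v} → Four v → v ≢ z → Inv c v) → Reply c z → NextMove c
  reply-move {z} fz nz an rest (e , α , l , sp , inv′) = e , α , l , λ st {v} fv → case v ≟ z of λ
    { (yes refl) → inv′ st ; (no ne) → spot-others fz nz an sp st fv ne (rest fv ne) }

  turn : Four z → Inv c z → Coloured c z → Turn c z
  turn fz (wait (waiting uz _ _ _)) kz = ⊥-elim (K-U kz uz)
  turn fz (plain pl kz b) _ = plain pl kz (plain-turn fz b)
  turn fz (centre C sz b) _ = centre C sz (inj₁ b)

  Complete? : ∀ (c : Col) → Complete G c ⊎ ∃ (Blank c)
  Complete? c with any? (u? c)
  ... | yes p = inj₂ p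
  ... | no ¬p = inj₁ λ e → [ id , (λ ue → ⊥-elim (¬p (e , ue))) ]′ (K⊎U c e)

  data Free (c : Col) : Set where
    root : Blank c e → par e ≡ nothing → Free c
    inner : Blank c e → Child e p → Coloured c p → Free c

  find-free : Blank c e → Free c
  find-free {c} {e} ue = go (suc (depth e)) ue ≤-refl
    where
    go : ∀ n {e} → Blank c e → depth e < n → Free c
    go (suc n) {e} ue (s≤s b) with par e in eq
    ... | nothing = root ue eq
    ... | just p with K⊎U c p
    ...   | inj₁ kp = inner ue eq kp
    ...   | inj₂ up′ = go n up′ (<-≤-trans (par-depth eq) b)

  -- The spare move. Below a coloured parent, or at the root, colouring an edge does not disturb the
  -- stars above. If the parent is at a 4-vertex, its star is answered as if it had been damaged.
  free-move : AllInv c → Blank c e → NextMove c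
  free-move {c} inv ue with find-free ue
  ... | root {e} ue eq = let (α , l) = inv-open inv ue in e , α , l , λ st {v} fv → case e ≼? v of λ
        { (no n) → inv-away st n (inv fv)
        ; (yes r) → case climb r of λ { (inj₁ refl) → claim st fv (inv fv)
                                      ; (inj₂ (_ , ce , _)) → ⊥-elim (just≢nothing ce eq) } }
  ... | inner {e} {p} ue ce kp with four? p
  ...   | yes fp with answer (inv-open inv) (turn fp (inv fp) kp)
  ...     | inj₁ r = reply-move fp (K-act kp self) (inj₁ kp) (λ fv _ → inv fv) r
  ...     | inj₂ all = ⊥-elim (K-U (all ce) ue)
  free-move {c} inv _ | inner {e} {p} ue ce kp | no np = let (α , l) = inv-open inv ue in e , α , l , keep
    where
    keep : Step c c′ e α → AllInv c′
    keep {c′ = c′} st {v} fv with e ≼? v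
    ... | no n = inv-away st n (inv fv)
    ... | yes r with climb r
    ...   | inj₁ refl = claim st fv (inv fv)
    ...   | inj₂ (p′ , ce′ , s) with just-injective (trans (sym ce′) ce)
    ...     | refl = go s
      where
      go : p ≼ v → Inv c′ v
      go self = ⊥-elim (np fv)
      go (up self cp) = inv-coloured st (up self ce) cp kp (inv fv)
      go (up (up s cy) ch) = inv-deep st (≼-trans (up self ce) s) cy ch (K-act kp s)
        (λ { refl → ⊥-elim (acyclic ce s) }) (inv fv)

  fine-move : AllInv c → Complete G c ⊎ NextMove c
  fine-move {c} inv with Complete? c
  ... | inj₁ full = inj₁ full
  ... | inj₂ (_ , ue) = inj₂ (free-move inv ue)

  next-move : Open c → Outcome c → Complete G c ⊎ NextMove c
  next-move op (fine inv) = fine-move inv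
  next-move {c} op (hurt {z} fz tn nz rest) with answer op tn
  ... | inj₁ r = inj₂ (reply-move fz nz (turn-anchored tn) rest r)
  -- With all three children coloured the star satisfies its invariant again, and the move is spent
  -- elsewhere.
  ... | inj₂ all = fine-move λ {v} fv → go fv (v ≟ z)
    where
    settled : Turn c z → (∀ {h} → Child h z → Coloured c h) → Inv c z
    settled (plain pl kz _) all = plain pl kz (done all)
    settled (centre C sz _) all = centre C sz (mild (all kid₃) (col (all kid₁)) (col (all kid₂)))
      where open Kids (Centre.kids C)
    go : Four v → Dec (v ≡ z) → Inv c v
    go fv (yes refl) = settled tn all
    go fv (no ne) = rest fv ne
  next-move op (broken {z} fz uz br nz rest above) with repair op uz fz br
  ... | e , α , l , inj₁ refl , inv′ = inj₂ (e , α , l , keep)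
    where
    keep : Step _ c′ z α → AllInv c′
    keep {c′ = c′} st {v} fv with v ≟ z
    ... | yes refl = inv′ st
    ... | no ne with child? z v
    ...   | yes cz = above fv cz st
    ...   | no nc with z ≼? v
    ...     | no n = inv-away st n (rest fv ne nc)
    ...     | yes r = go r
      where
      go : z ≼ v → Inv c′ v
      go self = ⊥-elim (ne refl)
      go (up self cz) = ⊥-elim (nc cz)
      go (up (up {h = y} s cy) ch) = inv-deep st s cy ch (λ a → nz (inact-≼ a s)) leaf (rest fv ne nc)
        where
        -- Were `z` a child of a 4-child of a centre, the path of that centre would have a fourth
        -- vertex.
        leaf : z ≡ y → ∀ {u w x} → Centre v u w x → ¬ Four _
        leaf refl C f4 with Kids.only (Centre.kids C) ch
        ... | inj₁ refl = Centre.leaf₁ C cy fz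
        ... | inj₂ (inj₁ refl) = Centre.leaf₂ C cy fz
        ... | inj₂ (inj₂ refl) = Centre.narrow₃ C f4
  ... | e , α , l , inj₂ (ce , top) , inv′ = inj₂ (reply-move fz nz (inj₂ top)
        (λ fv ne → rest fv ne λ cz → top cz fv) (e , α , l , kid ce , inv′))

  -- Termination of the game

  blank : Col → List Edge → ℕ
  blank c L = length (filter (u? c) L)

  blank-≤ : Step c c′ e α → ∀ L → blank c′ L ≤ blank c L
  blank-≤ st [] = z≤n
  blank-≤ {c} {c′} st (f ∷ L) with u? c f | u? c′ f
  ... | yes _ | yes _ = s≤s (blank-≤ st L)
  ... | yes _ | no _ = m≤n⇒m≤1+n (blank-≤ st L)
  ... | no _ | no _ = blank-≤ st L
  ... | no n | yes u = ⊥-elim (n (U-back st u))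

  blank-< : Step c c′ e α → ∀ {L} → e ∈ L → blank c′ L < blank c L
  blank-< {c} {c′} {e} st {f ∷ L} (here refl) with u? c f | u? c′ f
  ... | _ | yes u = ⊥-elim (just≢nothing (after st) u)
  ... | no n | no _ = ⊥-elim (n (before st))
  ... | yes _ | no _ = s≤s (blank-≤ st L)
  blank-< {c} {c′} st {f ∷ L} (there q) with u? c f | u? c′ f
  ... | yes _ | yes _ = s≤s (blank-< st q)
  ... | yes _ | no _ = m≤n⇒m≤1+n (blank-< st q)
  ... | no _ | no _ = blank-< st q
  ... | no n | yes u = ⊥-elim (n (U-back st u))

  -- `n` bounds the number of blank edges. It drops with each move of Alice and stays when Bob moves
  -- or passes, so his passes cannot prolong the recursion.
  alice : ∀ n {c} → blank c (allFin m) ≤ n → Open c → Outcome c → AliceWinsA G c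
  bob : ∀ n {c} → blank c (allFin m) ≤ n → AllInv c → AliceWinsB G c

  alice n b op out with next-move op out
  ... | inj₁ full = doneA full
  alice zero {c} b op out | inj₂ (e , α , l , _)
    with ≤-trans (blank-< (update-step {c = c} {α = α} (proj₁ l)) (∈-allFin e)) b
  ... | ()
  alice (suc n) b op out | inj₂ (e , α , l , inv′) =
    move (open-unblocked op) e α l
      (bob n (≤-pred (≤-trans (blank-< (update-step (proj₁ l)) (∈-allFin e)) b)) (inv′ (update-step (proj₁ l))))

  bob n b inv = reply (open-unblocked (inv-open inv)) (alice n b (inv-open inv) (fine inv)) λ e α l →
    let st = update-step (proj₁ l) in
    alice n (≤-trans (blank-≤ st (allFin m)) b) (step-open inv st) (Bob.outcome inv st)

  wins : AliceWinsGame G 5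
  wins = bob _ ≤-refl λ fz → wait (inact-waiting fz λ _ → refl)

-- Incidence in the tree, paths of 4-vertices and the choice of the root

Near : ℕ → ℕ → Set
Near a b = a ≡ suc b ⊎ b ≡ suc a

-- On a path with at most three vertices, two neighbours of a vertex are all it has.
near-middle : ∀ {a b c} → a ≤ 2 → c ≤ 2 → Near a b → Near b c → a ≢ c →
  (∀ d → Near b d → d ≡ a ⊎ d ≡ c) × (∀ d → d ≤ 2 → Near a d → d ≡ b)
near-middle a≤ c≤ (inj₁ refl) (inj₂ refl) a≢c = ⊥-elim (a≢c refl)
near-middle a≤ c≤ (inj₂ refl) (inj₁ eq) a≢c = ⊥-elim (a≢c (suc-injective eq))
near-middle (s≤s (s≤s z≤n)) c≤ (inj₁ refl) (inj₁ refl) a≢c =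
  (λ { _ (inj₁ refl) → inj₂ refl ; _ (inj₂ refl) → inj₁ refl }) ,
  λ { _ _ (inj₁ refl) → refl ; _ (s≤s (s≤s ())) (inj₂ refl) }
near-middle a≤ (s≤s (s≤s z≤n)) (inj₂ refl) (inj₂ refl) a≢c =
  (λ { _ (inj₁ refl) → inj₁ refl ; _ (inj₂ refl) → inj₂ refl }) ,
  λ { _ _ (inj₁ ()) ; _ _ (inj₂ refl) → refl }

least : ∀ {P : ℕ → Set} → (∀ n → Dec (P n)) → ∀ n → P n → ∃ λ k → P k × (∀ j → P j → k ≤ j)
least P? zero p = zero , p , λ _ _ → z≤n
least {P} P? (suc n) p with P? zero
... | yes p₀ = zero , p₀ , λ _ _ → z≤n
... | no ¬p₀ with least {P ∘ suc} (P? ∘ suc) n p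
...   | k , pk , min = suc k , pk , λ { zero p₀ → ⊥-elim (¬p₀ p₀) ; (suc j) pj → s≤s (min j pj) }

lookup-unique : ∀ {A : Set} {xs : List A} → Unique xs → ∀ i j → lookup xs i ≡ lookup xs j → i ≡ j
lookup-unique (a ∷ u) zero zero _ = refl
lookup-unique {xs = _ ∷ xs} (a ∷ u) zero (suc j) eq = ⊥-elim (All.lookup a (∈-lookup {xs = xs} j) eq)
lookup-unique {xs = _ ∷ xs} (a ∷ u) (suc i) zero eq = ⊥-elim (All.lookup a (∈-lookup {xs = xs} i) (sym eq))
lookup-unique (a ∷ u) (suc i) (suc j) eq = cong suc (lookup-unique u i j eq)

module _ {m : ℕ} where

  other? : (z f : Fin m) → Dec (f ≢ z)
  other? z f = ¬? (f ≟ z)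

  without : Fin m → List (Fin m) → List (Fin m)
  without z = filter (other? z)

  length-without : ∀ {z L} → Unique L → z ∈ L → length L ≡ suc (length (without z L))
  length-without {z} {f ∷ L} (a ∷ u) (here refl) = cong (suc ∘ length)
    (sym (trans (filter-reject (other? z) {x = f} {xs = L} (λ ne → ne refl)) (filter-all (other? z) (All.map (λ ne → ≢-sym ne) a))))
  length-without {z} {f ∷ L} (a ∷ u) (there q) = cong suc (trans (length-without u q)
    (cong length (sym (filter-accept (other? z) {x = f} {xs = L} λ { refl → All.lookup a q refl }))))

module Links (T : Graph) where
  open Graph T

  V E : Set
  V = Fin n
  E = Fin m

  Link : E → V → V → Set
  Link e v w = (proj₁ (ends e) ≡ v × proj₂ (ends e) ≡ w) ⊎ (proj₁ (ends e) ≡ w × proj₂ (ends e) ≡ v)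

  private variable
    e f g : E
    u v w x : V

  flip : Link e v w → Link e w v
  flip = swap

  link-≢ : Link e v w → v ≢ w
  link-≢ {e} (inj₁ (refl , q)) eq = loopless e (trans eq (sym q))
  link-≢ {e} (inj₂ (p , refl)) eq = loopless e (trans p (sym eq))

  link? : ∀ e v w → Dec (Link e v w)
  link? e v w = ((proj₁ (ends e) ≟ v) ×-dec (proj₂ (ends e) ≟ w)) ⊎-dec ((proj₁ (ends e) ≟ w) ×-dec (proj₂ (ends e) ≟ v))

  link-parallel : Link e v w → Link f v w → e ≡ f
  link-parallel {e} {_} {_} {f} (inj₁ (refl , refl)) (inj₁ (p , q)) = noParallel e f (inj₁ (sym p , sym q))
  link-parallel {e} {_} {_} {f} (inj₁ (refl , refl)) (inj₂ (p , q)) = noParallel e f (inj₂ (sym q , sym p))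
  link-parallel {e} {_} {_} {f} (inj₂ (refl , refl)) (inj₁ (p , q)) = noParallel e f (inj₂ (sym q , sym p))
  link-parallel {e} {_} {_} {f} (inj₂ (refl , refl)) (inj₂ (p , q)) = noParallel e f (inj₁ (sym p , sym q))

  link-incident : Link e v w → Incident T u e → u ≡ v ⊎ u ≡ w
  link-incident (inj₁ (p , q)) (inj₁ r) = inj₁ (trans (sym r) p)
  link-incident (inj₁ (p , q)) (inj₂ r) = inj₂ (trans (sym r) q)
  link-incident (inj₂ (p , q)) (inj₁ r) = inj₂ (trans (sym r) p)
  link-incident (inj₂ (p , q)) (inj₂ r) = inj₁ (trans (sym r) q)

  incident : Link e v w → Incident T v e
  incident (inj₁ (p , _)) = inj₁ p
  incident (inj₂ (_ , q)) = inj₂ q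

  other : Incident T v e → ∃ λ w → Link e v w
  other (inj₁ p) = _ , inj₁ (p , refl)
  other (inj₂ q) = _ , inj₂ (refl , q)

  link-adj : Link e v w → Adj T v w
  link-adj l = _ , (incident l , incident (flip l)) , link-≢ l

  adj-link : Adj T v w → ∃ λ e → Link e v w
  adj-link (e , (p , q) , ne) with other p
  ... | w′ , l with link-incident l q
  ...   | inj₁ r = ⊥-elim (ne (sym r))
  ...   | inj₂ refl = e , l

  at : V → List E
  at v = filter (incident? T v) (allFin m)

  at-unique : Unique (at v)
  at-unique {v} = filter⁺ (incident? T v) (allFin⁺ m)

  ∈-at : Incident T v e → e ∈ at v
  ∈-at {v} {e} p = ∈-filter⁺ (incident? T v) (∈-allFin e) p

  at-∈ : e ∈ at v → Incident T v e
  at-∈ {v = v} q = proj₂ (∈-filter⁻ (incident? T v) {xs = allFin m} q)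

  Four : V → Set
  Four = FourVertex T

  -- Among the positions 0, 1, 2 of the path only the middle one has two neighbours; so `v` sits
  -- there and `u`, `w` are the ends.
  triple : FourVerticesInducePathsLe2 T → Four u → Four v → Four w → Adj T u v → Adj T v w → u ≢ w →
    (∀ {x} → Four x → Adj T v x → x ≡ u ⊎ x ≡ w) × (∀ {x} → Four x → Adj T u x → x ≡ v)
  triple {u} {v} {w} paths fu fv fw uv vw u≢w with paths v fv
  ... | j , j≤2 , p , inj , comp , adj = first , second
    where
    adj-sym : ∀ {a b} → Adj T a b → Adj T b a
    adj-sym (e , (p , q) , ne) = e , (q , p) , ≢-sym ne
    ix : ∀ {x} → ReachIn T Four v x → ∃ λ i → p i ≡ x
    ix = proj₁ (comp _)
    Ix : V → Set
    Ix x = ∃ λ i → p i ≡ x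
    iv : Ix v
    iv = ix (here fv)
    iu : Ix u
    iu = ix (step fv (adj-sym uv) (here fu))
    iw : Ix w
    iw = ix (step fv vw (here fw))
    ≤2 : ∀ (i : Fin (suc j)) → toℕ i ≤ 2
    ≤2 i = ≤-trans (≤-pred (toℕ<n i)) j≤2
    near : ∀ {a b} (i : Ix a) (k : Ix b) → Adj T a b → Near (toℕ (proj₁ i)) (toℕ (proj₁ k))
    near (i , refl) (k , refl) ab = proj₁ (adj i k) ab
    same : ∀ {a b} (i : Ix a) (k : Ix b) → toℕ (proj₁ i) ≡ toℕ (proj₁ k) → a ≡ b
    same (i , refl) (k , refl) eq = cong p (toℕ-injective eq)
    differ : toℕ (proj₁ iu) ≢ toℕ (proj₁ iw)
    differ eq = u≢w (same iu iw eq)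
    both : (∀ d → Near (toℕ (proj₁ iv)) d → d ≡ toℕ (proj₁ iu) ⊎ d ≡ toℕ (proj₁ iw)) ×
           (∀ d → d ≤ 2 → Near (toℕ (proj₁ iu)) d → d ≡ toℕ (proj₁ iv))
    both = near-middle (≤2 (proj₁ iu)) (≤2 (proj₁ iw)) (near iu iv uv) (near iv iw vw) differ
    first : ∀ {x} → Four x → Adj T v x → x ≡ u ⊎ x ≡ w
    first fx vx with ix (step fv vx (here fx))
    ... | i with proj₁ both _ (near iv i vx)
    ...   | inj₁ eq = inj₁ (same i iu eq)
    ...   | inj₂ eq = inj₂ (same i iw eq)
    second : ∀ {x} → Four x → Adj T u x → x ≡ v
    second fx ux with ix (step fv (adj-sym uv) (step fu ux (here fx)))
    ... | i = same i iv (proj₂ both _ (≤2 (proj₁ i)) (near iu i ux))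

  -- If all degrees were 4, a vertex would have more than two neighbours of degree 4, against
  -- `triple`.
  root : MaxDegreeIs T 4 → FourVerticesInducePathsLe2 T → ∃ λ r → degree T r ≤ 3
  root deg paths with any? (λ v → ¬? (degree T v ℕ.≟ 4))
  ... | yes (r , ne) = r , ≤-pred (≤∧≢⇒< (proj₁ deg r) ne)
  ... | no all-four = ⊥-elim (absurd (proj₂ deg))
    where
    four : ∀ v → Four v
    four v with degree T v ℕ.≟ 4
    ... | yes p = p
    ... | no ¬p = ⊥-elim (all-four (v , ¬p))
    crowd : ∀ v (L : List E) → Unique L → (∀ {e} → e ∈ L → Incident T v e) → length L ≢ 4
    crowd v (a ∷ b ∷ c ∷ d ∷ []) ((ab ∷ ac ∷ _) ∷ (bc ∷ _) ∷ _) inc _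
      with other (inc (here refl)) | other (inc (there (here refl))) | other (inc (there (there (here refl))))
    ... | x , la | y , lb | z , lc
      with proj₁ (triple paths (four x) (four v) (four y) (link-adj (flip la)) (link-adj lb)
             (λ { refl → ab (link-parallel la lb) })) (four z) (link-adj lc)
    ...   | inj₁ refl = ac (link-parallel la lc)
    ...   | inj₂ refl = bc (link-parallel lb lc)
    absurd : (∃ λ v → degree T v ≡ 4) → ⊥
    absurd (v , dv) = crowd v (at v) at-unique at-∈ dv

  -- Distances from the root

  module Distance (connected : Connected T) (r : V) where

    Reach : ℕ → V → Set
    Reach zero v = v ≡ r
    Reach (suc k) v = ∃ λ e → ∃ λ w → Link e v w × Reach k w

    reach? : ∀ k v → Dec (Reach k v)
    reach? zero v = v ≟ r
    reach? (suc k) v = any? λ e → any? λ w → link? e v w ×-dec reach? k w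

    reach : ReachIn T (λ _ → ⊤) v r → ∃ λ k → Reach k v
    reach (here _) = zero , refl
    reach (step _ vw q) = let (e , l) = adj-link vw ; (k , p) = reach q in suc k , e , _ , l , p

    nearest : ∀ v → ∃ λ k → Reach k v × (∀ j → Reach j v → k ≤ j)
    nearest v = let (k , p) = reach (connected v r) in least (λ k → reach? k v) k p

    dist : V → ℕ
    dist v = proj₁ (nearest v)

    parent : ∀ v → v ≡ r ⊎ ∃ λ e → ∃ λ w → Link e v w × dist w < dist v
    parent v with nearest v
    ... | zero , p , _ = inj₁ p
    ... | suc k , (e , w , l , p) , _ = inj₂ (e , w , l , s≤s (proj₂ (proj₂ (nearest w)) k p))

-- Every edge leads from a vertex to its parent

module Orientation (T : Graph) (acyclic : ¬ HasCycle T) (r : Fin (Graph.n T)) (dist : Fin (Graph.n T) → ℕ)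
  (parent : ∀ v → v ≡ r ⊎ ∃ λ e → ∃ λ w → Links.Link T e v w × dist w < dist v) where
  open Graph T
  open Links T

  private variable
    e f g : E
    u v w x : V

  -- Trails that avoid the edge e, listing the vertices after the first one.
  data Trail (e : E) : V → List V → V → Set where
    stop : Trail e v [] v
    go   : ∀ {L} → Link f v w → f ≢ e → Trail e w L u → Trail e v (w ∷ L) u

  _++ᵗ_ : ∀ {L M} → Trail e v L w → Trail e w M u → ∃ λ N → Trail e v N u
  stop ++ᵗ t = _ , t
  go l ne s ++ᵗ t = _ , go l ne (proj₂ (s ++ᵗ t))

  reverseᵗ : ∀ {L} → Trail e v L w → ∃ λ M → Trail e w M v
  reverseᵗ stop = _ , stop
  reverseᵗ (go l ne t) = proj₂ (reverseᵗ t) ++ᵗ go (flip l) ne stop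

  suffix : ∀ {L} → Trail e w L u → Unique (w ∷ L) → v ∈ w ∷ L → ∃ λ M → Trail e v M u × Unique (v ∷ M)
  suffix t uq (here refl) = _ , t , uq
  suffix (go l ne t) (_ ∷ uq) (there q) = suffix t uq q

  simplify : ∀ {L} → Trail e v L u → ∃ λ M → Trail e v M u × Unique (v ∷ M)
  simplify stop = [] , stop , [] ∷ []
  simplify {v = v} (go {w = w} l ne t) with simplify t
  ... | M , s , uq with v ∈? (w ∷ M)
    where open DecMembership (_≟_ {n}) using (_∈?_)
  ...   | yes q = suffix s uq q
  ...   | no v∉ = w ∷ M , go l ne s , ¬Any⇒All¬ _ v∉ ∷ uq

  consecutive : ∀ {L} → Trail e v L u → ∀ i → Adj T (lookup (v ∷ L) (inject₁ i)) (lookup L i)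
  consecutive (go l ne t) zero = link-adj l
  consecutive (go l ne t) (suc i) = consecutive t i

  final : ∀ {L} → Trail e v L u → lookup (v ∷ L) (fromℕ (length L)) ≡ u
  final stop = refl
  final (go l ne t) = final t

  -- A shortcut of the trail visits no vertex twice. A single step would be an edge parallel to `e`,
  -- and anything longer closes to a cycle with `e`.
  no-detour : Link e v u → ∀ {L} → ¬ Trail e v L u
  no-detour l t = close l (simplify t)
    where
    close : Link e v u → ¬ ∃ λ M → Trail e v M u × Unique (v ∷ M)
    close l (_ , stop , _) = link-≢ l refl
    close l (_ , go l′ ne stop , _) = ne (link-parallel l′ l)
    -- Two steps give the three vertices that a cycle needs at least.
    close {v = v} l (w ∷ x ∷ L , t@(go _ _ (go _ _ _)) , uq) = acyclic (length L , lookup (v ∷ w ∷ x ∷ L) ,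
      (λ {i} {j} → lookup-unique uq i j) , consecutive t , subst (λ y → Adj T y v) (sym (final t)) (link-adj (flip l)))

  -- It fixes the value that `parent` returns, rather than asking for some closer neighbour along
  -- `e`; this is what makes the lower end determine the edge.
  TreeEdge : E → Set
  TreeEdge e = ∃ λ v → ∃ λ w → ∃ λ lk → parent v ≡ inj₂ (e , w , lk)

  tree-edge? : ∀ e v → (∃ λ w → ∃ λ lk → parent v ≡ inj₂ (e , w , lk)) ⊎ (∀ {f w lk} → parent v ≡ inj₂ (f , w , lk) → f ≢ e)
  tree-edge? e v with parent v
  ... | inj₁ _ = inj₂ λ ()
  ... | inj₂ (f , w , lk) with f ≟ e
  ...   | yes refl = inj₁ (w , lk , refl)
  ...   | no ne = inj₂ λ { refl → ne }

  home : (∀ v {f w lk} → parent v ≡ inj₂ (f , w , lk) → f ≢ e) → ∀ v → ∃ λ L → Trail e v L r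
  home {e} avoid v = go′ (suc (dist v)) v ≤-refl
    where
    go′ : ∀ k v → dist v < k → ∃ λ L → Trail e v L r
    go′ (suc k) v (s≤s b) with parent v in eq
    ... | inj₁ refl = [] , stop
    ... | inj₂ (f , w , l , lt) = _ , go l (avoid v eq) (proj₂ (go′ k w (<-≤-trans lt b)))

  -- Otherwise the parent chains from both ends of `e` reach the root without using `e`, and
  -- together they form a detour around it.
  all-tree : ∀ e → TreeEdge e
  all-tree e with tree-edge? e (proj₁ (ends e)) | tree-edge? e (proj₂ (ends e))
  ... | inj₁ p | _ = _ , p
  ... | inj₂ _ | inj₁ p = _ , p
  ... | inj₂ no₁ | inj₂ no₂ = ⊥-elim (no-detour (inj₁ (refl , refl))
          (proj₂ (proj₂ (home avoid _) ++ᵗ proj₂ (reverseᵗ (proj₂ (home avoid _))))))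
    where
    avoid : ∀ v {f w lk} → parent v ≡ inj₂ (f , w , lk) → f ≢ e
    avoid v {lk = l , _} eq refl with link-incident (inj₁ (refl , refl)) (incident l)
    ... | inj₁ refl = no₁ eq refl
    ... | inj₂ refl = no₂ eq refl

-- The rooted structure of the tree

module Rooting (T : Graph) (deg : MaxDegreeIs T 4) (paths : FourVerticesInducePathsLe2 T)
  (r : Fin (Graph.n T)) (r≤3 : degree T r ≤ 3) (dist : Fin (Graph.n T) → ℕ)
  (parent : ∀ v → v ≡ r ⊎ ∃ λ e → ∃ λ w → Links.Link T e v w × dist w < dist v)
  (all-tree : ∀ e → ∃ λ v → ∃ λ w → ∃ λ lk → parent v ≡ inj₂ (e , w , lk)) where
  open Graph T
  open Links T

  private variable
    e f g : E
    u v w x : V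

  Parent : V → E → V → Set
  Parent v e w = Link e v w × dist w < dist v

  low high : E → V
  low e = proj₁ (all-tree e)
  high e = proj₁ (proj₂ (all-tree e))

  parent-low : ∀ e → ∃ λ lk → parent (low e) ≡ inj₂ (e , high e , lk)
  parent-low e = proj₂ (proj₂ (all-tree e))

  low-high : ∀ e → Parent (low e) e (high e)
  low-high e = proj₁ (parent-low e)

  low-unique : Parent v e w → v ≡ low e × w ≡ high e
  low-unique {e = e} (l , lt) with low-high e
  ... | l′ , lt′ with link-incident l′ (incident l) | link-incident l′ (incident (flip l))
  ...   | inj₁ p | inj₂ q = p , q
  ...   | inj₁ refl | inj₁ refl = ⊥-elim (link-≢ l refl)
  ...   | inj₂ refl | inj₂ refl = ⊥-elim (link-≢ l refl)
  ...   | inj₂ refl | inj₁ refl = ⊥-elim (<-asym lt lt′)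

  low-injective : low e ≡ low f → e ≡ f
  low-injective {e} {f} eq with parent-low e | parent-low f
  ... | _ , p | _ , q rewrite eq with trans (sym p) q
  ...   | refl = refl

  edge-of : v ≡ r ⊎ (∃ λ e → ∃ λ w → Parent v e w) → Maybe E
  edge-of (inj₁ _) = nothing
  edge-of (inj₂ (e , _)) = just e

  par : E → Maybe E
  par e = edge-of (parent (high e))

  par-low : par e ≡ just f → low f ≡ high e
  par-low {e} eq with parent (high e)
  par-low refl | inj₂ (f , w , lk) = sym (proj₁ (low-unique lk))

  low-par : low f ≡ high e → par e ≡ just f
  low-par {f} {e} eq rewrite sym eq | proj₂ (parent-low f) = refl

  par-root : par e ≡ nothing → high e ≡ r
  par-root {e} eq with parent (high e)
  ... | inj₁ p = p

  FourEdge : E → Set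
  FourEdge e = Four (low e)

  open Shape par FourEdge

  depth : E → ℕ
  depth e = dist (low e)

  par-depth : Child e f → depth f < depth e
  par-depth {e} ch rewrite par-low ch = proj₂ (low-high e)

  adjacent : AdjEdges T e f → Up e f ⊎ Child f e
  adjacent {e} {f} (e≢f , v , ve , vf)
    with link-incident (proj₁ (low-high e)) ve | link-incident (proj₁ (low-high f)) vf
  ... | inj₁ p | inj₁ q = ⊥-elim (e≢f (low-injective (trans (sym p) q)))
  ... | inj₁ p | inj₂ q = inj₂ (low-par (trans (sym p) q))
  ... | inj₂ p | inj₁ q = inj₁ (inj₂ (low-par (trans (sym q) p)))
  ... | inj₂ p | inj₂ q = inj₁ (inj₁ (≢-sym e≢f , cong (edge-of ∘ parent) (trans (sym q) p)))

  incident-low : Incident T (low e) e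
  incident-low {e} = incident (proj₁ (low-high e))

  incident-high : Incident T (high e) e
  incident-high {e} = incident (flip (proj₁ (low-high e)))

  children : E → List E
  children z = without z (at (low z))

  child-∈ : Child f e → f ∈ children e
  child-∈ {f} {e} ch = ∈-filter⁺ _ (∈-at (subst (λ v → Incident T v f) (sym (par-low ch)) incident-high))
    λ { refl → <-irrefl refl (par-depth ch) }

  ∈-child : f ∈ children e → Child f e
  ∈-child {f} {e} q with ∈-filter⁻ (λ f → ¬? (f ≟ e)) {xs = at (low e)} q
  ... | q′ , ne with link-incident (proj₁ (low-high f)) (at-∈ q′)
  ...   | inj₁ p = ⊥-elim (ne (low-injective (sym p)))
  ...   | inj₂ p = low-par p

  children-unique : Unique (children e)
  children-unique {e} = filter⁺ _ at-unique

  degree-children : degree T (low e) ≡ suc (length (children e))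
  degree-children {e} = length-without at-unique (∈-at incident-low)

  four? : ∀ e → Dec (FourEdge e)
  four? e = degree T (low e) ℕ.≟ 4

  kids : ∀ {z} → FourEdge z → ∃ λ i → ∃ λ j → ∃ λ k → Kids z i j k
  kids {z} fz = three (children z) (suc-injective (trans (sym degree-children) fz)) children-unique child-∈ ∈-child
    where
    three : ∀ L → length L ≡ 3 → Unique L → (∀ {f} → Child f z → f ∈ L) → (∀ {f} → f ∈ L → Child f z) →
      ∃ λ i → ∃ λ j → ∃ λ k → Kids z i j k
    three (i ∷ j ∷ k ∷ []) _ ((ij ∷ ik ∷ []) ∷ (jk ∷ []) ∷ _) to from = i , j , k , record
      { kid₁ = from (here refl) ; kid₂ = from (there (here refl)) ; kid₃ = from (there (there (here refl)))
      ; ≢₁₂ = ij ; ≢₁₃ = ik ; ≢₂₃ = jk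
      ; only = λ ch → case to ch of λ
        { (here p) → inj₁ p ; (there (here p)) → inj₂ (inj₁ p) ; (there (there (here p))) → inj₂ (inj₂ p) } }

  two-of : ∀ (d : E) L → length L ≤ 2 → ∃ λ a → ∃ λ b → ∀ {f} → f ∈ L → f ≡ a ⊎ f ≡ b
  two-of d [] _ = d , d , λ ()
  two-of d (a ∷ []) _ = a , a , λ { (here p) → inj₁ p }
  two-of d (a ∷ b ∷ []) _ = a , b , λ { (here p) → inj₁ p ; (there (here p)) → inj₂ p }
  two-of d (_ ∷ _ ∷ _ ∷ _) (s≤s (s≤s ()))

  narrow : ∀ {x} → ¬ FourEdge x → ∃ λ y → ∃ λ y′ → ∀ {f} → Child f x → f ≡ y ⊎ f ≡ y′
  narrow {x} nf with two-of x (children x) (≤-pred (≤-pred (subst (_< 4) degree-children (≤∧≢⇒< (proj₁ deg (low x)) nf))))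
  ... | a , b , o = a , b , o ∘ child-∈

  roots : par e ≡ nothing → ∃ λ a → ∃ λ b → ∀ {t} → Up e t → t ≡ a ⊎ t ≡ b
  -- One of the at most three edges at the root is `e` itself, which leaves two.
  roots {e} eq with two-of e (without e (at r)) (≤-pred (subst (_≤ 3)
                      (length-without at-unique (∈-at (subst (λ v → Incident T v e) (par-root eq) incident-high))) r≤3))
  ... | a , b , o = a , b , λ
    { (inj₂ p) → ⊥-elim (just≢nothing p eq)
    ; (inj₁ (ne , p)) → o (∈-filter⁺ _ (∈-at (subst (λ v → Incident T v _) (par-root (trans p eq)) incident-high)) ne) }

  child-adj : Child f e → Adj T (low e) (low f)
  child-adj {f} ch rewrite par-low ch = link-adj (flip (proj₁ (low-high f)))

  child-adj′ : Child f e → Adj T (low f) (low e)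
  child-adj′ {f} ch rewrite par-low ch = link-adj (proj₁ (low-high f))

  module _ {z u w x : E} (ks : Kids z u w x) (fz : FourEdge z) (fu : FourEdge u) (fw : FourEdge w) where
    open Kids ks

    third-narrow : ¬ FourEdge x
    third-narrow fx with proj₁ (triple paths fu fz fw (child-adj′ kid₁) (child-adj kid₂) (≢₁₂ ∘ low-injective)) fx (child-adj kid₃)
    ... | inj₁ p = ≢₁₃ (sym (low-injective p))
    ... | inj₂ p = ≢₂₃ (sym (low-injective p))

    -- `u` is an end of the path, so its only neighbour of degree 4 is `z`, which lies above it.
    leaf : ∀ {k} → Child k u → ¬ FourEdge k
    leaf ch fk with low-injective (proj₂ (triple paths fu fz fw (child-adj′ kid₁) (child-adj kid₂) (≢₁₂ ∘ low-injective)) fk (child-adj ch))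
    ... | refl = <-asym (par-depth ch) (par-depth kid₁)

    top : ∀ {p} → Child z p → ¬ FourEdge p
    top ch fp with proj₁ (triple paths fu fz fw (child-adj′ kid₁) (child-adj kid₂) (≢₁₂ ∘ low-injective)) fp (child-adj′ ch)
    ... | inj₁ p with low-injective p
    ...   | refl = <-asym (par-depth ch) (par-depth kid₁)
    top ch fp | inj₂ p with low-injective p
    ...   | refl = <-asym (par-depth ch) (par-depth kid₂)

  centre : ∀ {z u w x} → Kids z u w x → FourEdge z → FourEdge u → FourEdge w → Centre z u w x
  centre ks fz fu fw = record { kids = ks ; four₁ = fu ; four₂ = fw ; narrow₃ = third-narrow ks fz fu fw
    ; leaf₁ = leaf ks fz fu fw ; leaf₂ = leaf (swap₁₂ ks) fz fw fu ; top = top ks fz fu fw }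

  one-four : ∀ {z i j k} → Kids z i j k → ¬ FourEdge i → ¬ FourEdge j → Plain z
  one-four ks ni nj ch ck h≢k with Kids.only ks ch | Kids.only ks ck
  ... | inj₁ refl | _ = inj₁ ni
  ... | inj₂ (inj₁ refl) | _ = inj₁ nj
  ... | _ | inj₁ refl = inj₂ ni
  ... | _ | inj₂ (inj₁ refl) = inj₂ nj
  ... | inj₂ (inj₂ refl) | inj₂ (inj₂ refl) = ⊥-elim (h≢k refl)

  kind : ∀ {z} → FourEdge z → Plain z ⊎ ∃ λ u → ∃ λ w → ∃ λ x → Centre z u w x
  kind fz with kids fz
  ... | _ , _ , _ , ks = go ks (four? _) (four? _) (four? _)
    where
    go : ∀ {i j k} → Kids _ i j k → Dec (FourEdge i) → Dec (FourEdge j) → Dec (FourEdge k) →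
      Plain _ ⊎ ∃ λ u → ∃ λ w → ∃ λ x → Centre _ u w x
    go ks (yes fi) (yes fj) _ = inj₂ (_ , _ , _ , centre ks fz fi fj)
    go ks (yes fi) _ (yes fk) = inj₂ (_ , _ , _ , centre (swap₂₃ ks) fz fi fk)
    go ks _ (yes fj) (yes fk) = inj₂ (_ , _ , _ , centre (swap₂₃ (swap₁₂ ks)) fz fj fk)
    go ks (no ni) (no nj) _ = inj₁ (one-four ks ni nj)
    go ks (no ni) _ (no nk) = inj₁ (one-four (swap₂₃ ks) ni nk)
    go ks _ (no nj) (no nk) = inj₁ (one-four (swap₂₃ (swap₁₂ ks)) nj nk)

  rooted : Rooted T
  rooted = record
    { par = par ; depth = depth ; Four = FourEdge ; par-depth = par-depth ; adjacent = adjacent ; four? = four?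
    ; kids = kids ; narrow = narrow ; roots = roots ; kind = kind }

rooted-tree : (T : Graph) → IsTree T → MaxDegreeIs T 4 → FourVerticesInducePathsLe2 T → Rooted T
rooted-tree T (connected , no-cycle) deg paths = Rooting.rooted T deg paths r r≤3 dist parent
  (Orientation.all-tree T no-cycle r dist parent)
  where
  r : Fin (Graph.n T)
  r = proj₁ (Links.root T deg paths)
  r≤3 : degree T r ≤ 3
  r≤3 = proj₂ (Links.root T deg paths)
  open Links.Distance T connected r using (dist; parent)

theorem1 : (T : Graph) → IsTree T → MaxDegreeIs T 4 → FourVerticesInducePathsLe2 T → GameChromaticIndexLe T 5
theorem1 T tree deg paths = 5 , ≤-refl , Strategy.wins T (rooted-tree T tree deg paths)
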